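{- Let $N\in\mathbb{N}$ and let $w\in\mathcal{A}_N^{\mathbb{N}}$ be an infinite word that is not eventually periodic and such that there is a constant $C>0$ with $P(w,n)\le n+C$ for all $n\in\mathbb{N}$. Then $(w,\mathbf{x}_p)\notin\mathbf{LMad}$ for every $\mathbf{x}_p\in\mathbf{P}^1(\mathbb{Q}_p)$.
   Context: $P(w,n)$ is the number of distinct factors (blocks of consecutive letters) of length $n$ occurring in $w$. Fix a prime $p$; $|\cdot|_p$ is the $p$-adic absolute value. For $N\in\mathbb{N}$ let $\mathcal{A}_N=\{1,\dots,N\}$. For an infinite word $w=a_1a_2\ldots$ over the positive integers, $\mathrm{T}w=a_2a_3\ldots$. For $a\in\mathbb{N}$ put $A_a=\begin{pmatrix}0&1\\1&a\end{pmatrix}$. Points of $\mathbf{P}^1(\mathbb{Q}_p)$ are column vectors $(q_1,q_2)^T$ in homogeneous coordinates, and $\mathrm{T}(w,\mathbf{q})=(\mathrm{T}w,A_{a_1}\mathbf{q})$. For $\epsilon>0$, $\mathbf{q}=(q_1,q_2)\in\mathbf{PBad}_\epsilon$ if for all $(a,b)\in\mathbb{Z}^2\setminus\{(0,0)\}$, $\frac{|aq_1+bq_2|_p}{\max\{|q_1|_p,|q_2|_p\}}\ge\frac{\epsilon}{\max\{a^2,b^2\}}$. $\mathbf{LMad}_\epsilon$ is the set of pairs $(w,\mathbf{x}_p)$ with $\mathrm{T}^n(w,\mathbf{x}_p)\in\mathcal{A}_N^{\mathbb{N}}\times\mathbf{PBad}_\epsilon$ for all integers $n\ge0$, where $N=\lfloor\epsilon^{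 -1}\rfloor+1$; $\mathbf{LMad}=\bigcup_{\epsilon>0}\mathbf{LMad}_\epsilon$. -}

module Defs where

open import Data.Nat using (ℕ; zero; suc; _+_; _*_; _^_; _≤_; _<_; _⊔_; _/_)
open import Data.Integer as ℤ using (ℤ; +_; ∣_∣)
open import Data.Integer.Divisibility as ℤd using ()
open import Data.Fin using (Fin; toℕ)
open import Data.Vec using (Vec; tabulate)
open import Data.List using (List; length)
open import Data.List.Membership.Propositional using (_∈_)
open import Data.List.Relation.Unary.All using (All)
open import Data.List.Relation.Unary.Unique.Propositional using (Unique)
open import Data.Product using (Σ; _×_; _,_; proj₁; proj₂)
open import Data.Sum using (_⊎_)
open import Relation.Binary.PropositionalEquality using (_≡_)
open import Relation.Nullary using (¬_)

-- Infinite words over the positive integers: w : ℕ → ℕ, with w 0 = a₁.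

InAlphabet : ℕ → (ℕ → ℕ) → Set
InAlphabet N w = ∀ i → 1 ≤ w i × w i ≤ N

shift : (ℕ → ℕ) → (ℕ → ℕ)
shift w i = w (suc i)

factor : (ℕ → ℕ) → (n i : ℕ) → Vec ℕ n
factor w n i = tabulate (λ j → w (i + toℕ j))

Occurs : (ℕ → ℕ) → {n : ℕ} → Vec ℕ n → Set
Occurs w {n} u = Σ ℕ λ i → factor w n i ≡ u

-- P(w,n) ≤ k : the set of distinct factors of length n has at most k
-- elements, i.e. every duplicate-free list of such factors has length ≤ k.
ComplexityAtMost : (ℕ → ℕ) → (n k : ℕ) → Set
ComplexityAtMost w n k =
  (us : List (Vec ℕ n)) → Unique us → All (Occurs w) us → length us ≤ k

EventuallyPeriodic : (ℕ → ℕ) → Set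
EventuallyPeriodic w =
  Σ ℕ λ n₀ → Σ ℕ λ per → 1 ≤ per × (∀ i → n₀ ≤ i → w (i + per) ≡ w i)

-- p-adic integers as coherent sequences of residues: r k represents the
-- class of x modulo p^k, and r (k+1) ≡ r k (mod p^k).

record ℤp (p : ℕ) : Set where
  field
    res : ℕ → ℤ
    coh : ∀ k → (+ (p ^ k)) ℤd.∣ (res (suc k) ℤ.- res k)
open ℤp public

-- raw pairs of residue sequences (homogeneous coordinates)
RawPair : Set
RawPair = (ℕ → ℤ) × (ℕ → ℤ)

-- a point of P¹(ℚ_p): every point has homogeneous coordinates in ℤ_p²,
-- not both zero (x ≠ 0 in ℤ_p iff some residue is nonzero mod p^k)
record P1 (p : ℕ) : Set where
  field
    q₁ q₂ : ℤp p
    nonzero : Σ ℕ λ k → ¬ ((+ (p ^ k)) ℤd.∣ res q₁ k) ⊎ ¬ ((+ (p ^ k)) ℤd.∣ res q₂ k)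
open P1 public

coords : {p : ℕ} → P1 p → RawPair
coords x = res (q₁ x) , res (q₂ x)

actA : ℕ → RawPair → RawPair
actA a (r₁ , r₂) = r₂ , (λ k → r₁ k ℤ.+ (+ a) ℤ.* r₂ k)

Tmap : (ℕ → ℕ) × RawPair → (ℕ → ℕ) × RawPair
Tmap (w , q) = shift w , actA (w 0) q

Titer : ℕ → (ℕ → ℕ) × RawPair → (ℕ → ℕ) × RawPair
Titer zero    s = s
Titer (suc n) s = Titer n (Tmap s)

-- PBad_ε with ε = u / v (u, v ≥ 1 naturals).
-- |a q₁ + b q₂|_p / max(|q₁|_p,|q₂|_p) ≥ ε / m  (m = max(a²,b²))
-- ⇔ v_p(a q₁ + b q₂) - min(v_p q₁, v_p q₂) ≤ K for some K with p^K ≤ m/ε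
-- ⇔ ∃ K, p^K·u ≤ m·v, ∃ j with p^j | q₁, p^j | q₂ and p^(j+K+1) ∤ a q₁ + b q₂.

maxSq : ℤ → ℤ → ℕ
maxSq a b = (∣ a ∣ * ∣ a ∣) ⊔ (∣ b ∣ * ∣ b ∣)

PBadε : (p u v : ℕ) → RawPair → Set
PBadε p u v (r₁ , r₂) =
  (a b : ℤ) → ¬ (a ≡ + 0 × b ≡ + 0) →
  Σ ℕ λ K → (p ^ K * u ≤ maxSq a b * v) ×
  (Σ ℕ λ j → ((+ (p ^ j)) ℤd.∣ r₁ j) × ((+ (p ^ j)) ℤd.∣ r₂ j) ×
    ¬ ((+ (p ^ suc (j + K))) ℤd.∣ (a ℤ.* r₁ (suc (j + K)) ℤ.+ b ℤ.* r₂ (suc (j + K)))))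

-- LMad_ε with ε = (suc u) / (suc v); N = ⌊1/ε⌋ + 1 = ⌊(suc v)/(suc u)⌋ + 1
LMadε : (p u v : ℕ) → (ℕ → ℕ) → RawPair → Set
LMadε p u v w q =
  ∀ n → InAlphabet (suc v / suc u + 1) (proj₁ (Titer n (w , q)))
      × PBadε p (suc u) (suc v) (proj₂ (Titer n (w , q)))

-- LMad = ⋃_{ε>0} LMad_ε (rational ε suffice, as LMad_ε grows as ε shrinks)
LMad : (p : ℕ) → (ℕ → ℕ) → RawPair → Set
LMad p w q = Σ ℕ λ u → Σ ℕ λ v → LMadε p u v w q

-- Fix K and follow the residues Q_j of the orbit modulo p^K. A word of complexity ≤ n + C that is
-- not eventually periodic has a recurrent tail in which, for n ≥ n₀, exactly one factor of length n
-- is followed by two different letters. Collect the states Q_j seen after all occurrences of a long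
-- factor; when the factor contains one whose set of states is minimal, this family of sets is
-- carried to itself by the letters of w. Invertibility of the letters together with uniqueness of
-- the branching factor shows that the set at a position depends only on the n₀ preceding letters,
-- with n₀ independent of K. Two loops at the branching factor of length n₀ that leave it through
-- different letters therefore give two fixed matrices E, E′ and, for every K, a non-empty set of
-- states modulo p^K invariant under both.
--
-- Replace E, E′ by powers congruent to 1 modulo p². If y is in the invariant set, take (Dirichlet) a
-- short integer vector v with p^(2l) ∣ v·y. Were v·(E − 1)y of valuation < 2l, Hensel lifting along
-- the orbit of E would produce a state y′ with v·y′ divisible by a power of p that PBad forbids. So
-- y is an eigenvector of E, and likewise of E′, modulo p^l. Eliminating between the two quadratic
-- equations gives a fixed non-zero integer form vanishing at y modulo a large power of p, which PBad
-- forbids as well; the form is non-zero because the words of E and E′ start with different letters.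

{-# OPTIONS --safe #-}
module Submission where

open import Defs
open import Data.Nat as ℕ using (ℕ; zero; suc; z≤n; s≤s)
import Data.Nat.Properties as ℕₚ
open import Data.Nat.Primality using (Prime)
open import Data.Fin as Fin using (Fin; toℕ; fromℕ<; combine; remQuot)
open import Data.Fin.Properties using (toℕ-fromℕ<; toℕ-injective; toℕ<n; fromℕ<-injective; combine-injective; combine-remQuot; pigeonhole)
open import Data.List using (List; []; _∷_; _++_; length; map; applyUpTo) renaming (lookup to lookupᴸ)
open import Data.List.Relation.Unary.All as All using (All; []; _∷_)
import Data.List.Relation.Unary.All.Properties as Allₚ
open import Data.Product using (Σ; _×_; _,_; proj₁; proj₂)
open import Data.Sum using (_⊎_; inj₁; inj₂)
open import Data.Empty using (⊥; ⊥-elim)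
open import Relation.Binary.Definitions using (tri<; tri≈; tri>)
open import Relation.Binary.PropositionalEquality
open import Relation.Nullary using (¬_; Dec; yes; no; _×-dec_; _⊎-dec_)
open import Relation.Nullary.Decidable using (decidable-stable; map′)

module Combinatorics where
  open import Data.Nat using (_+_; _∸_; _⊔_; _≤_; _<_; z<s; s≤s⁻¹)
  open import Data.Nat.Properties
  open import Data.Nat.Tactic.RingSolver using (solve-∀)
  open import Data.List.Properties using (length-map; length-applyUpTo)
  open import Data.List.Membership.Propositional using (_∈_; find)
  open import Data.List.Membership.Propositional.Properties using (∈-lookup)
  open import Data.List.Relation.Unary.Any as Any using (here; there)
  open import Data.List.Relation.Unary.AllPairs as AllPairs using (AllPairs; []; _∷_)
  import Data.List.Relation.Unary.AllPairs.Properties as AllPairsₚ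
  open import Data.Vec using (lookup)
  open import Data.Vec.Properties using (lookup∘tabulate)

  -- Classical existence through double negation.

  infixl 1 _>>=_

  -- The theorem is a negation, so classical existence claims about `w` may be used under `¬ ¬`;
  -- decidable conclusions are extracted with `decidable-stable`.
  _>>=_ : {A B : Set} → ¬ ¬ A → (A → ¬ ¬ B) → ¬ ¬ B
  (m >>= f) k = m (λ a → f a k)

  return : {A : Set} → A → ¬ ¬ A
  return a k = k a

  ¬¬-maximum : (X : ℕ → Set) {M : ℕ} → X 0 → (∀ m → X m → m ≤ M) →
               ¬ ¬ (Σ ℕ λ m → X m × ¬ X (suc m))
  ¬¬-maximum X {M} x₀ bound k = all (suc M) λ x → <-irrefl refl (bound _ x)
    where
    all : ∀ m → ¬ ¬ X m
    all zero    = return x₀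
    all (suc m) = all m >>= λ x ¬x → k (m , x , ¬x)

  ¬¬-least : (P : ℕ → Set) → (∀ n → Dec (P n)) → ¬ (∀ n → P n) →
             ¬ ¬ (Σ ℕ λ n → ¬ P n × (∀ m → m < n → P m))
  ¬¬-least P P? ¬all k = ¬all λ n → below (suc n) n ≤-refl
    where
    below : ∀ n m → m < n → P m
    below (suc n) m (s≤s m≤n) = decidable-stable (P? m) λ ¬Pm →
      k (m , ¬Pm , λ i i<m → below n i (<-≤-trans i<m m≤n))

  -- Factors of a word, branching factors and complexity.

  module Words (w : ℕ → ℕ) where

    Agree : ℕ → ℕ → ℕ → Set
    Agree n i j = ∀ t → t < n → w (i + t) ≡ w (j + t)

    agree? : ∀ n i j → Dec (Agree n i j)
    agree? n i j = map′ (λ f t t<n → f t<n) (λ f {t} t<n → f t t<n)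
      (allUpTo? (λ t → w (i + t) ≟ w (j + t)) n)

    agree-refl : ∀ {n i} → Agree n i i
    agree-refl t _ = refl

    agree-sym : ∀ {n i j} → Agree n i j → Agree n j i
    agree-sym a t t<n = sym (a t t<n)

    agree-trans : ∀ {n i j k} → Agree n i j → Agree n j k → Agree n i k
    agree-trans a b t t<n = trans (a t t<n) (b t t<n)

    agree-take : ∀ {m n i j} → m ≤ n → Agree n i j → Agree m i j
    agree-take m≤n a t t<m = a t (<-≤-trans t<m m≤n)

    agree-drop : ∀ d {n i j} → Agree (d + n) i j → Agree n (i + d) (j + d)
    agree-drop d {n} {i} {j} a t t<n =
      trans (cong w (+-assoc i d t)) (trans (a (d + t) (+-monoʳ-< d t<n)) (cong w (sym (+-assoc j d t))))

    agree-tail : ∀ {n i j} → Agree (suc n) i j → Agree n (suc i) (suc j)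
    agree-tail {n} {i} {j} a t t<n =
      trans (cong w (sym (+-suc i t))) (trans (a (suc t) (s≤s t<n)) (cong w (+-suc j t)))

    agree-snoc : ∀ {n i j} → Agree n i j → w (i + n) ≡ w (j + n) → Agree (suc n) i j
    agree-snoc a e t (s≤s t≤n) with m≤n⇒m<n∨m≡n t≤n
    ... | inj₁ t<n  = a t t<n
    ... | inj₂ refl = e

    agree-next : ∀ {n i j} → Agree n i j → w (i + n) ≡ w (j + n) → Agree n (suc i) (suc j)
    agree-next a e = agree-tail (agree-snoc a e)

    -- This is a right special factor, represented by two occurrences with different continuations.
    Branch : ℕ → ℕ → ℕ → Set
    Branch n i j = Agree n i j × w (i + n) ≢ w (j + n)

    branch-tail : ∀ {n i j} → Branch (suc n) i j → Branch n (suc i) (suc j)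
    branch-tail {n} {i} {j} (a , ne) =
      agree-tail a , λ e → ne (trans (cong w (+-suc i n)) (trans e (cong w (sym (+-suc j n)))))

    branch-sym : ∀ {n i j} → Branch n i j → Branch n j i
    branch-sym (a , ne) = agree-sym a , λ e → ne (sym e)

    SameBranch : ℕ → (i j i′ j′ : ℕ) → Set
    SameBranch n i j i′ j′ = w (i + n) ≡ w (i′ + n) × w (j + n) ≡ w (j′ + n)

    Coincide : ℕ → (i j i′ j′ : ℕ) → Set
    Coincide n i j i′ j′ = Agree n i i′ × (SameBranch n i j i′ j′ ⊎ SameBranch n i j j′ i′)

    -- This also limits the branching factor to two continuations: a third would give a branch whose
    -- pair of letters does not coincide with the first pair.
    UniqueBranch : ℕ → ℕ → Set
    UniqueBranch T n = ∀ {i j i′ j′} → T ≤ i → T ≤ j → T ≤ i′ → T ≤ j′ →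
      Branch n i j → Branch n i′ j′ → Coincide n i j i′ j′

    -- Factors are counted by positions rather than as vectors, so a list that is valid at length
    -- `n` stays valid at every greater length.
    Apart : ℕ → List ℕ → Set
    Apart n = AllPairs (λ i j → ¬ Agree n i j)

    New : ℕ → ℕ → List ℕ → Set
    New n i = All (λ l → ¬ Agree n i l)

    apart-suc : ∀ {n L} → Apart n L → Apart (suc n) L
    apart-suc = AllPairs.map λ ¬a a → ¬a (agree-take (n≤1+n _) a)

    apart-unique : ∀ {n L l l′} → Apart n L → l ∈ L → l′ ∈ L → Agree n l l′ → l ≡ l′
    apart-unique (_ ∷ _)  (here refl) (here refl) _ = refl
    apart-unique (r ∷ _)  (here refl) (there m′)  a = ⊥-elim (All.lookup r m′ a)
    apart-unique (r ∷ _)  (there m)   (here refl) a = ⊥-elim (All.lookup r m (agree-sym a))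
    apart-unique (_ ∷ ap) (there m)   (there m′)  a = apart-unique ap m m′ a

    -- `L` holds at most one occurrence of the branching factor, and that occurrence has only one
    -- continuation. So one of the two continuations is missing from `L`.
    new-of-branch : ∀ {n i j L} → Apart n L → Branch n i j → New (suc n) i L ⊎ New (suc n) j L
    new-of-branch {n} {i} {j} {L} ap (a , ne) with Any.any? (agree? (suc n) i) L
    ... | no ¬some = inj₁ (Allₚ.¬Any⇒All¬ L ¬some)
    ... | yes some with find some
    ... | l , l∈L , il = inj₂ (All.tabulate λ {l′} l′∈L jl′ → ne (clash l′ l′∈L jl′))
      where
      clash : ∀ l′ → l′ ∈ L → Agree (suc n) j l′ → w (i + n) ≡ w (j + n)
      clash l′ l′∈L jl′ with apart-unique ap l∈L l′∈L
        (agree-trans (agree-sym (agree-take (n≤1+n n) il)) (agree-trans a (agree-take (n≤1+n n) jl′)))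
      ... | refl = trans (il n ≤-refl) (sym (jl′ n ≤-refl))

    Complexity≤ : ℕ → Set
    Complexity≤ C = ∀ n L → Apart n L → length L ≤ n + C

    ¬¬-repetition : ∀ {C} → Complexity≤ C → ∀ n T →
      ¬ ¬ (Σ ℕ λ a → Σ ℕ λ b → a < b × b ≤ n + C × Agree n (T + a) (T + b))
    ¬¬-repetition {C} cx n T k = <-irrefl refl (subst (_≤ n + C) (length-applyUpTo (T +_) (suc (n + C)))
      (cx n (applyUpTo (T +_) (suc (n + C)))
        (AllPairsₚ.applyUpTo⁺₁ (T +_) _ λ { {i} {j} i<j (s≤s j≤) a → k (i , j , i<j , j≤ , a) })))

    -- The Morse-Hedlund argument: without branching beyond `T`, each factor of length `n`
    -- determines the next letter, and a repeated factor then forces periodicity.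
    ¬¬-branch : ∀ {C} → Complexity≤ C → ¬ EventuallyPeriodic w → ∀ n T →
      ¬ ¬ (Σ ℕ λ i → Σ ℕ λ j → T ≤ i × T ≤ j × Branch n i j)
    ¬¬-branch {C} cx ¬ep n T k = ¬¬-repetition cx n T λ { (a , b , a<b , _ , ag) →
      ¬ep (T + a + n , b ∸ a , m<n⇒0<n∸m a<b , periodic a b a<b ag) }
      where
      module _ (a b : ℕ) (a<b : a < b) (ag : Agree n (T + a) (T + b)) where
        letter : ∀ {i j} → T ≤ i → T ≤ j → Agree n i j → w (i + n) ≡ w (j + n)
        letter {i} {j} Ti Tj g = decidable-stable (_ ≟ _) λ ne → k (i , j , Ti , Tj , g , ne)

        T≤ : ∀ c t → T ≤ t + (T + c)
        T≤ c t = m≤n⇒m≤o+n t (m≤m+n T c)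

        agrees : ∀ t → Agree n (t + (T + a)) (t + (T + b))
        agrees zero    = ag
        agrees (suc t) = agree-next (agrees t) (letter (T≤ a t) (T≤ b t) (agrees t))

        periodic : ∀ i → T + a + n ≤ i → w (i + (b ∸ a)) ≡ w i
        periodic i le = sym (subst₂ (λ x y → w x ≡ w y) e₁ e₂ (letter (T≤ a t) (T≤ b t) (agrees t)))
          where
          t = i ∸ (T + a + n)
          e₁ : t + (T + a) + n ≡ i
          e₁ = trans (+-assoc t (T + a) n) (m∸n+n≡m le)
          e₂ : t + (T + b) + n ≡ i + (b ∸ a)
          e₂ = begin
            t + (T + b) + n              ≡⟨ cong (λ z → t + (T + z) + n) (sym (m+[n∸m]≡n (<⇒≤ a<b))) ⟩
            t + (T + (a + (b ∸ a))) + n  ≡⟨ cong (λ z → t + z + n) (sym (+-assoc T a _)) ⟩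
            t + (T + a + (b ∸ a)) + n    ≡⟨ cong (_+ n) (sym (+-assoc t (T + a) _)) ⟩
            t + (T + a) + (b ∸ a) + n    ≡⟨ +-assoc (t + (T + a)) (b ∸ a) n ⟩
            t + (T + a) + ((b ∸ a) + n)  ≡⟨ cong (t + (T + a) +_) (+-comm (b ∸ a) n) ⟩
            t + (T + a) + (n + (b ∸ a))  ≡⟨ sym (+-assoc (t + (T + a)) n _) ⟩
            t + (T + a) + n + (b ∸ a)    ≡⟨ cong (_+ (b ∸ a)) e₁ ⟩
            i + (b ∸ a) ∎
            where open ≡-Reasoning

    Many : ℕ → ℕ → ℕ → Set
    Many T n c = Σ (List ℕ) λ L → Apart n L × All (T ≤_) L × n + c ≤ length L

    -- Stabilisation of the excess of complexity over length.

    module Stabilisation (C : ℕ) (cx : Complexity≤ C) (¬ep : ¬ EventuallyPeriodic w) where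

      -- A branch supplies one further factor whenever the length grows by one, so the excess `c` is
      -- never lost.
      many-suc : ∀ {T n c} → Many T n c → ¬ ¬ Many T (suc n) c
      many-suc {T} {n} {c} (L , ap , ge , len) = ¬¬-branch cx ¬ep n T >>= λ where
          (i , j , Ti , Tj , br) → return (add i j Ti Tj (new-of-branch ap br))
        where
        add : ∀ i j → T ≤ i → T ≤ j → New (suc n) i L ⊎ New (suc n) j L → Many T (suc n) c
        add i j Ti Tj (inj₁ new) = i ∷ L , new ∷ apart-suc ap , Ti ∷ ge , s≤s len
        add i j Ti Tj (inj₂ new) = j ∷ L , new ∷ apart-suc ap , Tj ∷ ge , s≤s len

      many-+ : ∀ {T n c} d → Many T n c → ¬ ¬ Many T (d + n) c
      many-+ zero    B = return B
      many-+ (suc d) B = many-+ d B >>= many-suc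

      Persistent : ℕ → Set
      Persistent c = ∀ T → ¬ ¬ (Σ ℕ λ n → Many T n c)

      -- The excess is bounded by `C`, so there is a largest one that survives in all tails. Its
      -- maximality yields a `T` beyond which the excess `suc c` never occurs.
      ¬¬-excess : ¬ ¬ (Σ ℕ λ c → Persistent c × ¬ Persistent (suc c))
      ¬¬-excess = ¬¬-maximum Persistent {C} (λ T → return (0 , [] , [] , [] , z≤n)) λ m pm →
        decidable-stable (m ≤? C) λ m≰C → pm 0 λ { (n , L , ap , _ , len) →
          m≰C (+-cancelˡ-≤ n m C (≤-trans len (cx n L ap))) }

      module Tail (T c : ℕ) (pers : Persistent c) (few : ∀ n → ¬ Many T n (suc c)) where

        -- If the factor of length `n + m` at `s` did not return beyond `T′`, it could be added to
        -- `n + m + c` factors found there, and the excess would rise to `suc c`.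
        recurrent : ∀ s n T′ → T ≤ s → ¬ ¬ (Σ ℕ λ t → T′ ≤ t × Agree n s t)
        recurrent s n T′ T≤s = pers (T ⊔ T′) >>= λ where
            (m , B) → many-+ n B >>= λ where
              (L , ap , ge , len) → return (search m L ap ge len)
          where
          search : ∀ m L → Apart (n + m) L → All (T ⊔ T′ ≤_) L → n + m + c ≤ length L →
            Σ ℕ λ t → T′ ≤ t × Agree n s t
          search m L ap ge len with Any.any? (agree? (n + m) s) L
          ... | no ¬some = ⊥-elim (few (n + m) (s ∷ L , Allₚ.¬Any⇒All¬ L ¬some ∷ ap ,
            T≤s ∷ All.map (≤-trans (m≤m⊔n T T′)) ge , subst (_≤ suc (length L)) (sym (+-suc (n + m) c)) (s≤s len)))
          ... | yes some with find some
          ... | t , t∈L , ag = t , ≤-trans (m≤n⊔m T T′) (All.lookup ge t∈L) , agree-take (m≤m+n n m) ag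

        -- Together with `L` the two would make `n + c + 2` factors of length `suc n`, an excess of
        -- `suc c`.
        no-two-new : ∀ {n L e₁ e₂} → Apart n L → All (T ≤_) L → n + c ≤ length L → T ≤ e₁ → T ≤ e₂ →
          New (suc n) e₁ L → New (suc n) e₂ L → ¬ ¬ Agree (suc n) e₁ e₂
        no-two-new {n} {L} {e₁} {e₂} ap ge len T₁ T₂ new₁ new₂ ¬ag =
          few (suc n) (e₁ ∷ e₂ ∷ L , (¬ag ∷ new₁) ∷ (new₂ ∷ apart-suc ap) , T₁ ∷ T₂ ∷ ge ,
            s≤s (subst (_≤ suc (length L)) (sym (+-suc n c)) (s≤s len)))

        module _ (n : ℕ) (B : Many T n c) where
          private
            L   = proj₁ B
            ap  = proj₁ (proj₂ B)
            ge  = proj₁ (proj₂ (proj₂ B))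
            len = proj₂ (proj₂ (proj₂ B))

          two-branches : ∀ {e i j} → T ≤ e → T ≤ i → T ≤ j → New (suc n) e L → Branch n i j →
            ¬ (¬ Agree (suc n) e i × ¬ Agree (suc n) e j)
          two-branches Te Ti Tj new br (¬i , ¬j) with new-of-branch ap br
          ... | inj₁ newi = no-two-new ap ge len Te Ti new newi ¬i
          ... | inj₂ newj = no-two-new ap ge len Te Tj new newj ¬j

          -- Different branching factors would each contribute a factor of length `suc n` missing
          -- from `L`, and there is room for only one.
          branch-agree : ∀ {i j i′ j′} → T ≤ i → T ≤ j → T ≤ i′ → T ≤ j′ →
            Branch n i j → Branch n i′ j′ → Agree n i i′
          branch-agree {i} {j} {i′} {j′} Ti Tj Ti′ Tj′ br@(a , _) br′@(a′ , _) =
            decidable-stable (agree? n i i′) λ ¬ag → contra ¬ag (new-of-branch ap br)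
            where
            prefix : ∀ {x y} → Agree (suc n) x y → Agree n x y
            prefix = agree-take (n≤1+n n)

            contra : ¬ Agree n i i′ → ¬ (New (suc n) i L ⊎ New (suc n) j L)
            contra ¬ag (inj₁ new) = two-branches Ti Ti′ Tj′ new br′
              ((λ x → ¬ag (prefix x)) , λ x → ¬ag (agree-trans (prefix x) (agree-sym a′)))
            contra ¬ag (inj₂ new) = two-branches Tj Ti′ Tj′ new br′
              ((λ x → ¬ag (agree-trans a (prefix x))) ,
               λ x → ¬ag (agree-trans a (agree-trans (prefix x) (agree-sym a′))))

          -- Three continuations leave two of them missing from `L`: one comes from the first pair,
          -- another from the pair avoiding it.
          no-triple-branch : ∀ {i j k} → T ≤ i → T ≤ j → T ≤ k →
            Branch n i j → Branch n i k → ¬ Branch n j k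
          no-triple-branch Ti Tj Tk ij ik jk with new-of-branch ap ij
          ... | inj₁ new = two-branches Ti Tj Tk new jk
            ((λ x → proj₂ ij (x n ≤-refl)) , λ x → proj₂ ik (x n ≤-refl))
          ... | inj₂ new = two-branches Tj Ti Tk new ik
            ((λ x → proj₂ ij (sym (x n ≤-refl))) , λ x → proj₂ jk (x n ≤-refl))

          unique-branch : UniqueBranch T n
          unique-branch {i} {j} {i′} {j′} Ti Tj Ti′ Tj′ br@(a , ne) br′@(a′ , ne′) = ii′ , letters
            where
            ii′ : Agree n i i′
            ii′ = branch-agree Ti Tj Ti′ Tj′ br br′

            ij′ : Agree n i j′
            ij′ = agree-trans ii′ a′

            no-third : ∀ {k} → T ≤ k → Agree n i k → w (i + n) ≢ w (k + n) → ¬ (w (j + n) ≢ w (k + n))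
            no-third Tk ik ne₁ ne₂ =
              no-triple-branch Ti Tj Tk br (ik , ne₁) (agree-trans (agree-sym a) ik , ne₂)

            letters : SameBranch n i j i′ j′ ⊎ SameBranch n i j j′ i′
            letters with w (i + n) ≟ w (i′ + n) | w (j + n) ≟ w (j′ + n)
            ... | yes p | yes q = inj₁ (p , q)
            ... | yes p | no ¬q = ⊥-elim (no-third Tj′ ij′ (λ e → ne′ (trans (sym p) e)) ¬q)
            ... | no ¬p | _ with w (j + n) ≟ w (i′ + n)
            ...   | no ¬r = ⊥-elim (no-third Ti′ ii′ ¬p ¬r)
            ...   | yes r with w (i + n) ≟ w (j′ + n)
            ...     | yes q = inj₂ (q , r)
            ...     | no ¬q = ⊥-elim (no-third Tj′ ij′ ¬q λ e → ne′ (trans (sym r) e))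

    record Recurrence : Set where
      field
        n₀        : ℕ
        recurrent : ∀ s n T → ¬ ¬ (Σ ℕ λ t → T ≤ t × Agree n s t)
        branches  : ∀ n T → ¬ ¬ (Σ ℕ λ i → Σ ℕ λ j → T ≤ i × T ≤ j × Branch n i j)
        unique    : ∀ {n i j i′ j′} → n₀ ≤ n → Branch n i j → Branch n i′ j′ →
                    Coincide n i j i′ j′

  -- Passage to a recurrent tail.

  tail : ℕ → (ℕ → ℕ) → ℕ → ℕ
  tail T w i = w (T + i)

  module _ (w : ℕ → ℕ) where
    open Words

    complexity≤ : ∀ {C} → (∀ n → ComplexityAtMost w n (n + C)) → Complexity≤ w C
    complexity≤ {C} cx n L ap = subst (_≤ n + C) (length-map (factor w n) L)
      (cx n (map (factor w n) L)
        (AllPairsₚ.map⁺ (AllPairs.map (λ ¬a e → ¬a (agree e)) ap))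
        (Allₚ.map⁺ (All.tabulate λ {i} _ → i , refl)))
      where
      agree : ∀ {i j} → factor w n i ≡ factor w n j → Agree w n i j
      agree {i} {j} e t t<n = subst (λ t → w (i + t) ≡ w (j + t)) (toℕ-fromℕ< t<n)
        (trans (sym (lookup∘tabulate _ (fromℕ< t<n)))
          (trans (cong (λ v → lookup v (fromℕ< t<n)) e) (lookup∘tabulate _ (fromℕ< t<n))))

    tail-agree : ∀ T {n i j} → Agree (tail T w) n i j → Agree w n (T + i) (T + j)
    tail-agree T {n} {i} {j} a t t<n =
      trans (cong w (+-assoc T i t)) (trans (a t t<n) (cong w (sym (+-assoc T j t))))

    agree-tail⁻ : ∀ T {n i j} → Agree w n (T + i) (T + j) → Agree (tail T w) n i j
    agree-tail⁻ T {n} {i} {j} a t t<n =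
      trans (cong w (sym (+-assoc T i t))) (trans (a t t<n) (cong w (+-assoc T j t)))

    tail-complexity : ∀ T {C} → Complexity≤ w C → Complexity≤ (tail T w) C
    tail-complexity T {C} cx n L ap = subst (_≤ n + C) (length-map (T +_) L)
      (cx n (map (T +_) L) (AllPairsₚ.map⁺ (AllPairs.map (λ ¬a a → ¬a (agree-tail⁻ T a)) ap)))

    tail-¬periodic : ∀ T → ¬ EventuallyPeriodic w → ¬ EventuallyPeriodic (tail T w)
    tail-¬periodic T ¬ep (m , per , 1≤per , periodic) = ¬ep (T + m , per , 1≤per , λ i le →
      let i′ = i ∸ T
          e : T + i′ ≡ i
          e = m+[n∸m]≡n (≤-trans (m≤m+n T m) le)
      in trans (cong w (trans (cong (_+ per) (sym e)) (+-assoc T i′ per)))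
           (trans (periodic i′ (+-cancelˡ-≤ T m i′ (subst (T + m ≤_) (sym e) le))) (cong w e)))

    tail-recurrence : ∀ {C} → Complexity≤ w C → ¬ EventuallyPeriodic w →
      ¬ ¬ (Σ ℕ λ T → Recurrence (tail T w))
    tail-recurrence {C} cx ¬ep = ¬¬-excess >>= λ where
        (c , pers , ¬pers) →
          (λ k → ¬pers λ T ¬many → k (T , λ n B → ¬many (n , B))) >>= λ where
            (T , few) → pers T >>= λ where
              -- Any length at which the excess `c` is reached beyond `T` can serve as `n₀`, because
              -- `many-+` carries the excess to all greater lengths.
              (n₀ , B) → return (T , record
                { n₀        = n₀
                ; recurrent = rec T c pers few
                ; branches  = ¬¬-branch (tail T w) (tail-complexity T cx) (tail-¬periodic T ¬ep)
                ; unique    = uniq T c pers few n₀ B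
                })
      where
      open Stabilisation w C cx ¬ep
      module _ (T c : ℕ) (pers : Persistent c) (few : ∀ n → ¬ Many w T n (suc c)) where
        open Tail T c pers few

        rec : ∀ s n T′ → ¬ ¬ (Σ ℕ λ t → T′ ≤ t × Agree (tail T w) n s t)
        rec s n T′ = recurrent (T + s) n (T + T′) (m≤m+n T s) >>= λ where
          (t , le , a) → return (t ∸ T , m+n≤o⇒m≤o∸n T′ (subst (_≤ t) (+-comm T T′) le) ,
            agree-tail⁻ T (subst (Agree w n (T + s)) (sym (m+[n∸m]≡n (≤-trans (m≤m+n T T′) le))) a))

        tail-branch : ∀ {n i j} → Branch (tail T w) n i j → Branch w n (T + i) (T + j)
        tail-branch {n} {i} {j} (a , ne) = tail-agree T a , λ e → ne
          (trans (cong w (sym (+-assoc T i n))) (trans e (cong w (+-assoc T j n))))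

        uniq : ∀ n₀ → Many w T n₀ c → ∀ {n i j i′ j′} → n₀ ≤ n →
          Branch (tail T w) n i j → Branch (tail T w) n i′ j′ → Coincide (tail T w) n i j i′ j′
        uniq n₀ B {n} {i} {j} {i′} {j′} n₀≤n br br′ = shift-back (decidable-stable coincide?
            (many-+ (n ∸ n₀) B >>= λ B′ → return
              (unique-branch n (subst (λ z → Many w T z c) (m∸n+n≡m n₀≤n) B′)
                (m≤m+n T i) (m≤m+n T j) (m≤m+n T i′) (m≤m+n T j′) (tail-branch br) (tail-branch br′))))
          where
          coincide? : Dec (Coincide w n (T + i) (T + j) (T + i′) (T + j′))
          coincide? = agree? w n _ _ ×-dec ((_ ≟ _ ×-dec _ ≟ _) ⊎-dec (_ ≟ _ ×-dec _ ≟ _))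

          letter : ∀ {x y} → w (T + x + n) ≡ w (T + y + n) → w (T + (x + n)) ≡ w (T + (y + n))
          letter {x} {y} e = trans (cong w (sym (+-assoc T x n))) (trans e (cong w (+-assoc T y n)))

          shift-back : Coincide w n (T + i) (T + j) (T + i′) (T + j′) → Coincide (tail T w) n i j i′ j′
          shift-back (a , inj₁ (p , q)) = agree-tail⁻ T a , inj₁ (letter p , letter q)
          shift-back (a , inj₂ (p , q)) = agree-tail⁻ T a , inj₂ (letter p , letter q)

  -- Finite state spaces with injective letter actions.

  lookup-allPairs : ∀ {A : Set} {R : A → A → Set} {L} → AllPairs R L →
    ∀ {i j} → i Fin.< j → R (lookupᴸ L i) (lookupᴸ L j)
  lookup-allPairs (r ∷ _)  {Fin.zero}  {Fin.suc j} _         = All.lookup r (∈-lookup j)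
  lookup-allPairs (_ ∷ rs) {Fin.suc i} {Fin.suc j} (s≤s i<j) = lookup-allPairs rs i<j

  -- The intended instances are integer vectors modulo `p ^ K`. `code` expresses finiteness without
  -- forming a quotient; on a finite space `act-inj` amounts to invertibility of the letters.
  record StateSpace : Set₁ where
    infix 4 _≈_
    field
      State     : Set
      _≈_       : State → State → Set
      ≈-refl    : ∀ {x} → x ≈ x
      ≈-sym     : ∀ {x y} → x ≈ y → y ≈ x
      ≈-trans   : ∀ {x y z} → x ≈ y → y ≈ z → x ≈ z
      act       : ℕ → State → State
      act-cong  : ∀ a {x y} → x ≈ y → act a x ≈ act a y
      act-inj   : ∀ a {x y} → act a x ≈ act a y → x ≈ y
      size      : ℕ
      code      : State → Fin size
      code-inj  : ∀ {x y} → code x ≡ code y → x ≈ y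

    actList : List ℕ → State → State
    actList []       x = x
    actList (a ∷ as) x = actList as (act a x)

    distinct-bound : ∀ {L} → AllPairs (λ x y → ¬ x ≈ y) L → length L ≤ size
    distinct-bound {L} ap = ≮⇒≥ λ lt → clash (pigeonhole lt (λ i → code (lookupᴸ L i)))
      where
      clash : ¬ (Σ _ λ i → Σ _ λ j → i Fin.< j × code (lookupᴸ L i) ≡ code (lookupᴸ L j))
      clash (i , j , i<j , e) = lookup-allPairs ap i<j (code-inj e)

  letters : (ℕ → ℕ) → ℕ → ℕ → List ℕ
  letters w i zero    = []
  letters w i (suc m) = w i ∷ letters w (suc i) m

  letters-cong : ∀ w {m i j} → Words.Agree w m i j → letters w i m ≡ letters w j m
  letters-cong w {zero}          _ = refl
  letters-cong w {suc m} {i} {j} a = cong₂ _∷_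
    (subst₂ (λ x y → w x ≡ w y) (+-identityʳ i) (+-identityʳ j) (a 0 z<s))
    (letters-cong w (Words.agree-tail w a))

  -- Bounded gaps and uniform recurrence.

  module Recurrent (w : ℕ → ℕ) (R : Words.Recurrence w) (C : ℕ)
                   (cx : Words.Complexity≤ w C) (¬ep : ¬ EventuallyPeriodic w) where
    open Words w
    open Recurrence R

    ¬¬-first-difference : ∀ {i j} → i < j → ¬ ¬ (Σ ℕ λ n → Branch n i j)
    ¬¬-first-difference {i} {j} i<j =
      ¬¬-least (λ t → w (i + t) ≡ w (j + t)) (λ t → _ ≟ _) not-all >>= λ where
          (n , ne , a) → return (n , a , ne)
      where
      not-all : ¬ (∀ t → w (i + t) ≡ w (j + t))
      not-all eq = ¬ep (i , j ∸ i , m<n⇒0<n∸m i<j , λ k i≤k →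
        let t = k ∸ i
            e₁ : i + t ≡ k
            e₁ = m+[n∸m]≡n i≤k
            e₂ : j + t ≡ k + (j ∸ i)
            e₂ = trans (cong (_+ t) (sym (m+[n∸m]≡n (<⇒≤ i<j))))
              (trans (+-assoc i (j ∸ i) t) (trans (cong (i +_) (+-comm (j ∸ i) t))
                (trans (sym (+-assoc i t _)) (cong (_+ (j ∸ i)) e₁))))
        in sym (subst₂ (λ x y → w x ≡ w y) e₁ e₂ (eq t)))

    -- If the branching factor of length N did not start in [s , s + N + C], a repetition among
    -- these positions would propagate deterministically and make w eventually periodic.
    branching-gap : ∀ {N i j} → n₀ ≤ N → Branch N i j → ∀ s →
      Σ ℕ λ d → d < suc (N + C) × Agree N (s + d) i
    branching-gap {N} {i} {j} n₀≤N br s = decidable-stable found? λ ¬found →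
      ¬¬-repetition cx N s λ { (a , b , a<b , b≤ , ag) → absurd ¬found a b a<b b≤ ag }
      where
      found? : Dec (Σ ℕ λ d → d < suc (N + C) × Agree N (s + d) i)
      found? = anyUpTo? (λ d → agree? N (s + d) i) (suc (N + C))

      module _ (¬found : ¬ (Σ ℕ λ d → d < suc (N + C) × Agree N (s + d) i))
               (a b : ℕ) (a<b : a < b) (b≤ : b ≤ N + C) (ag : Agree N (s + a) (s + b)) where
        x per : ℕ
        x   = s + a
        per = b ∸ a

        a+per : a + per ≡ b
        a+per = m+[n∸m]≡n (<⇒≤ a<b)

        x+per : x + per ≡ s + b
        x+per = trans (+-assoc s a per) (cong (s +_) a+per)

        letter : ∀ {e y} → e < per → Agree N (x + e) y → w (x + e + N) ≡ w (y + N)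
        letter {e} {y} e<per g = decidable-stable (_ ≟ _) λ ne → ¬found
          (a + e , <-≤-trans (+-monoʳ-< a e<per) (≤-trans (≤-reflexive a+per) (m≤n⇒m≤1+n b≤)) ,
           subst (λ z → Agree N z i) (+-assoc s a e) (proj₁ (unique n₀≤N (g , ne) br)))

        -- Both positions are compared with `x + e` in the first period, since only there does
        -- `¬found` exclude a branch.
        Follow : ℕ → Set
        Follow t = Σ ℕ λ e → e < per × Agree N (x + e) (x + t) × Agree N (x + e) (x + per + t)

        follow : ∀ t → Follow t
        follow zero    = 0 , m<n⇒0<n∸m a<b , agree-refl ,
          subst₂ (Agree N) (sym (+-identityʳ x)) (trans (sym x+per) (sym (+-identityʳ (x + per)))) ag
        follow (suc t) with follow t
        ... | e , e<per , g , h with m≤n⇒m<n∨m≡n e<per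
        ...   | inj₁ lt = suc e , lt , step g , step h
          where
          step : ∀ {y} → Agree N (x + e) (y + t) → Agree N (x + suc e) (y + suc t)
          step {y} k = subst₂ (Agree N) (sym (+-suc x e)) (sym (+-suc y t)) (agree-next k (letter e<per k))
        ...   | inj₂ eq = 0 , m<n⇒0<n∸m a<b , step g , step h
          where
          step : ∀ {y} → Agree N (x + e) (y + t) → Agree N (x + 0) (y + suc t)
          step {y} k = agree-trans
            (subst₂ (Agree N) (sym (+-identityʳ x)) (sym x+per) ag)
            (subst₂ (Agree N) (trans (sym (+-suc x e)) (cong (x +_) eq)) (sym (+-suc y t))
              (agree-next k (letter e<per k)))

        absurd : ⊥
        absurd = ¬ep (x + N , per , m<n⇒0<n∸m a<b , λ k le →
          let t = k ∸ (x + N)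
              f = follow t
              e₁ : x + t + N ≡ k
              e₁ = trans (shuffle₁ x t N) (m+[n∸m]≡n le)
              e₂ : x + per + t + N ≡ k + per
              e₂ = trans (shuffle₂ x per t N) (cong (_+ per) (m+[n∸m]≡n le))
          in sym (subst₂ (λ x y → w x ≡ w y) e₁ e₂
            (trans (sym (letter (proj₁ (proj₂ f)) (proj₁ (proj₂ (proj₂ f)))))
              (letter (proj₁ (proj₂ f)) (proj₂ (proj₂ (proj₂ f)))))))
          where
          shuffle₁ : ∀ x t N → x + t + N ≡ x + N + t
          shuffle₁ = solve-∀
          shuffle₂ : ∀ x p t N → x + p + t + N ≡ x + N + t + p
          shuffle₂ = solve-∀

    -- The factor at `s₀` is a prefix of a branching factor: it returns at some `s₁`, and the first
    -- difference between the two continuations gives a branch. Branching factors have bounded gaps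
    -- by `branching-gap`.
    uniformly-recurrent : ∀ s₀ ℓ → ¬ ¬ (Σ ℕ λ n → ∀ s → Σ ℕ λ d → d + ℓ ≤ n × Agree ℓ (s + d) s₀)
    uniformly-recurrent s₀ ℓ = recurrent s₀ (ℓ + n₀) (suc s₀) >>= λ where
        (s₁ , s₀<s₁ , a) → ¬¬-first-difference s₀<s₁ >>= λ where
          (N , br) → return (gap N br (≮⇒≥ λ lt → proj₂ br (a N lt)))
      where
      gap : ∀ N {s₁} → Branch N s₀ s₁ → ℓ + n₀ ≤ N →
        Σ ℕ λ n → ∀ s → Σ ℕ λ d → d + ℓ ≤ n × Agree ℓ (s + d) s₀
      gap N br le = N + C + N , λ s →
        let d , d< , a = branching-gap (≤-trans (m≤n+m n₀ ℓ) le) br s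
            ℓ≤N = ≤-trans (m≤m+n ℓ n₀) le
        in d , +-mono-≤ (s≤s⁻¹ d<) ℓ≤N , agree-take ℓ≤N a

    -- States seen after the occurrences of a factor.

    Follows : (𝕊 : StateSpace) → (ℕ → StateSpace.State 𝕊) → Set
    Follows 𝕊 Q = ∀ i → Q (suc i) ≈ act (w i) (Q i)
      where open StateSpace 𝕊

    module States (𝕊 : StateSpace) (Q : ℕ → StateSpace.State 𝕊) (Q-step : Follows 𝕊 Q) where
      open StateSpace 𝕊

      transport : ∀ m {i j} → Agree m i j → Q i ≈ Q j → Q (i + m) ≈ Q (j + m)
      transport zero    {i} {j} _ q = subst₂ (λ x y → Q x ≈ Q y) (sym (+-identityʳ i)) (sym (+-identityʳ j)) q
      transport (suc m) {i} {j} a q = subst₂ (λ x y → Q x ≈ Q y) (sym (+-suc i m)) (sym (+-suc j m))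
        (≈-trans (Q-step (i + m)) (≈-trans
          (subst (λ z → act (w (i + m)) (Q (i + m)) ≈ act z (Q (i + m))) (a m ≤-refl) ≈-refl)
          (≈-trans (act-cong _ (transport m (agree-take (n≤1+n m) a) q)) (≈-sym (Q-step (j + m))))))

      -- Minimality of the set of seen states is expressed by maximising a list of unseen ones. Such
      -- lists are bounded by `size`, and a state unseen for a factor stays unseen for its
      -- extensions.
      Avoids : ℕ → Set
      Avoids m = Σ ℕ λ s → Σ ℕ λ a → Σ ℕ λ ℓ → a ≤ ℓ × Σ (List State) λ L →
        AllPairs (λ x y → ¬ x ≈ y) L ×
        All (λ x → ∀ s′ → Agree ℓ s s′ → ¬ (Q (s′ + a) ≈ x)) L × m ≤ length L

      -- Every state seen at offset a of an occurrence of the factor is also seen there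
      -- when the occurrence is required to extend to any longer factor containing it.
      Saturated : ℕ → ℕ → ℕ → Set
      Saturated s a ℓ = ∀ s₂ d ℓ₂ j → Agree ℓ (s₂ + d) s → d + ℓ ≤ ℓ₂ → Agree ℓ s j →
        ¬ ¬ (Σ ℕ λ j₂ → Agree ℓ₂ s₂ j₂ × Q (j₂ + (d + a)) ≈ Q (j + a))

      -- A factor avoiding the largest possible number of states is saturated.
      ¬¬-saturated : ¬ ¬ (Σ ℕ λ s → Σ ℕ λ a → Σ ℕ λ ℓ → a ≤ ℓ × Saturated s a ℓ)
      ¬¬-saturated = ¬¬-maximum Avoids {size} (0 , 0 , 0 , z≤n , [] , [] , [] , z≤n)
          (λ { m (_ , _ , _ , _ , L , ap , _ , le) → ≤-trans le (distinct-bound ap) }) >>= λ where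
        (m , (s , a , ℓ , a≤ℓ , L , ap , av , le) , ¬more) → return (s , a , ℓ , a≤ℓ ,
          λ s₂ d ℓ₂ j as dℓ aj k → ¬more (s₂ , d + a , ℓ₂ , ≤-trans (+-monoʳ-≤ d a≤ℓ) dℓ , Q (j + a) ∷ L ,
            All.map (λ f → f j aj) av ∷ ap ,
            (λ s′ a₂ q → k (s′ , a₂ , q)) ∷
            All.map (λ {x} f s′ a₂ q → f (s′ + d)
              (agree-trans (agree-sym as) (agree-drop d (agree-take dℓ a₂)))
              (subst (λ z → Q z ≈ x) (sym (+-assoc s′ d a)) q)) av ,
            s≤s le))

      module Local (s₀ a ℓ n : ℕ) (a≤ℓ : a ≤ ℓ) (sat : Saturated s₀ a ℓ)
                   (dense : ∀ s → Σ ℕ λ d → d + ℓ ≤ n × Agree ℓ (s + d) s₀) where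

        -- The double negation makes membership provable from classical existence claims such as
        -- `refine`.
        S : ℕ → State → Set
        S s x = ¬ ¬ (Σ ℕ λ j → Agree n s j × Q (j + n) ≈ x)

        -- The window of length `n` at `s + k` contains the saturated factor. Saturation replaces
        -- `j` by an occurrence of the longer factor with the same state at offset `a` of the
        -- saturated one, and both then read the same `r` letters up to the end of the window.
        refine : ∀ k s j {ℓ₂} → k + n ≤ ℓ₂ → Agree n (s + k) j →
          ¬ ¬ (Σ ℕ λ j₂ → Agree ℓ₂ s j₂ × Q (j₂ + k + n) ≈ Q (j + n))
        refine k s j {ℓ₂} le ag with dense (s + k)
        ... | d , dℓ≤n , ad = sat s (k + d) ℓ₂ (j + d)
              (subst (λ z → Agree ℓ z s₀) (+-assoc s k d) ad)
              (≤-trans (≤-reflexive (+-assoc k d ℓ)) (≤-trans (+-monoʳ-≤ k dℓ≤n) le))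
              (agree-trans (agree-sym ad) (agree-drop d (agree-take dℓ≤n ag))) >>= λ where
                (j₂ , a₂ , q) → return (j₂ , a₂ ,
                  subst₂ (λ x y → Q x ≈ Q y) (e₁ j₂) e₂ (transport r (mid j₂ a₂) q))
          where
          r = n ∸ (d + a)
          d+a+r : d + a + r ≡ n
          d+a+r = m+[n∸m]≡n (≤-trans (+-monoʳ-≤ d a≤ℓ) dℓ≤n)
          rearrange : ∀ j k d a r → j + (k + d + a) + r ≡ j + k + (d + a + r)
          rearrange = solve-∀
          e₁ : ∀ j₂ → j₂ + (k + d + a) + r ≡ j₂ + k + n
          e₁ j₂ = trans (rearrange j₂ k d a r) (cong (j₂ + k +_) d+a+r)
          e₂ : j + d + a + r ≡ j + n
          e₂ = trans (trans (cong (_+ r) (+-assoc j d a)) (+-assoc j (d + a) r)) (cong (j +_) d+a+r)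
          mid : ∀ j₂ → Agree ℓ₂ s j₂ → Agree r (j₂ + (k + d + a)) (j + d + a)
          mid j₂ a₂ = subst₂ (Agree r)
            (trans (+-assoc j₂ k (d + a)) (cong (j₂ +_) (sym (+-assoc k d a)))) (sym (+-assoc j d a))
            (agree-drop (d + a) (subst (λ z → Agree z (j₂ + k) j) (sym d+a+r)
              (agree-trans (agree-sym (agree-drop k (agree-take le a₂))) ag)))

        forward : ∀ {s x} → S s x → S (suc s) (act (w (s + n)) x)
        forward {s} {x} Sx = Sx >>= λ where
          (j , ag , q) → refine 0 s j (n≤1+n n) (subst (λ z → Agree n z j) (sym (+-identityʳ s)) ag) >>= λ where
            (j₂ , a₂ , q₂) → return (suc j₂ , agree-tail a₂ ,
              ≈-trans (Q-step (j₂ + n)) (subst (λ z → act z (Q (j₂ + n)) ≈ act (w (s + n)) x) (a₂ n ≤-refl)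
                (act-cong _ (≈-trans (subst (λ z → Q (z + n) ≈ Q (j + n)) (+-identityʳ j₂) q₂) q))))

        -- The occurrence is first extended by one letter to the left. The window at `s` ends one
        -- letter earlier, and `act-inj` undoes that last letter.
        backward : ∀ {s x} → S (suc s) (act (w (s + n)) x) → S s x
        backward {s} {x} Sx = Sx >>= λ where
          (j , ag , q) → refine 1 s j ≤-refl (subst (λ z → Agree n z j) (+-comm 1 s) ag) >>= λ where
            (j₂ , a₂ , q₂) → return (j₂ , agree-take (n≤1+n n) a₂ ,
              act-inj (w (s + n)) (≈-trans
                (subst (λ z → act (w (s + n)) (Q (j₂ + n)) ≈ act z (Q (j₂ + n))) (a₂ n ≤-refl) ≈-refl)
                (≈-trans (≈-sym (Q-step (j₂ + n)))
                  (≈-trans (subst (λ z → Q (z + n) ≈ Q (j + n)) (+-comm j₂ 1) q₂) q))))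

        _⊑_ : ℕ → ℕ → Set
        s ⊑ s′ = ∀ {x} → S s x → S s′ x

        step : ∀ {s s′} → w (s + n) ≡ w (s′ + n) → suc s ⊑ suc s′ → s ⊑ s′
        step {s} {s′} e le Sx = backward (subst (λ z → S (suc s′) (act z _)) e (le (forward Sx)))

        -- The state sets depend only on the m letters before the position, for every m ≥ n₀:
        -- two occurrences of a branching factor are linked through the longer branching factor.
        descent : ∀ e m → e + m ≡ n → n₀ ≤ m → ∀ s s′ → Agree m (s + e) (s′ + e) → s ⊑ s′
        descent zero m refl n₀≤m s s′ ag Sx = Sx >>= λ where
          (j , aj , q) → return (j , agree-trans
            (agree-sym (subst₂ (Agree n) (+-identityʳ s) (+-identityʳ s′) ag)) aj , q)
        descent (suc e) m e+m n₀≤m s s′ ag = result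
          where
          e+sm : e + suc m ≡ n
          e+sm = trans (+-suc e m) e+m

          letter : ∀ s → w (s + suc e + m) ≡ w (s + n)
          letter s = cong w (trans (+-assoc s (suc e) m) (cong (s +_) e+m))

          same : ∀ {s s′} → Agree m (s + suc e) (s′ + suc e) → w (s + n) ≡ w (s′ + n) → s ⊑ s′
          same {s} {s′} ag eq = step eq (descent e (suc m) e+sm (m≤n⇒m≤1+n n₀≤m) (suc s) (suc s′)
            (agree-snoc (subst₂ (Agree m) (+-suc s e) (+-suc s′ e) ag)
              (trans (cong (λ z → w (z + m)) (sym (+-suc s e))) (trans (letter s) (trans eq
                (trans (sym (letter s′)) (cong (λ z → w (z + m)) (+-suc s′ e))))))))

          module _ (ne : w (s + n) ≢ w (s′ + n)) where

            -- The chain is `s ⊑ i ⊑ j ⊑ s′`. The outer inclusions have the same letter after the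
            -- window; the middle one has windows ending in `suc m` common letters.
            linked : ∀ i j → Branch (suc m) (i + e) (j + e) →
              SameBranch m (s + suc e) (s′ + suc e) (i + suc e) (j + suc e) →
              Agree m (s + suc e) (i + suc e) → s ⊑ s′
            linked i j (bij , _) (p , q) ai Sx =
              same (agree-sym (agree-trans (agree-sym ag) (agree-trans ai aij)))
                (sym (trans (sym (letter s′)) (trans q (letter j))))
                (descent e (suc m) e+sm (m≤n⇒m≤1+n n₀≤m) i j bij
                  (same ai (trans (sym (letter s)) (trans p (letter i))) Sx))
              where
              aij : Agree m (i + suc e) (j + suc e)
              aij = subst₂ (Agree m) (sym (+-suc i e)) (sym (+-suc j e)) (agree-tail bij)

            through : ∀ i j → Branch (suc m) (i + e) (j + e) → s ⊑ s′
            through i j b = choose (unique n₀≤m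
                (ag , λ eq → ne (trans (sym (letter s)) (trans eq (letter s′)))) b′)
              where
              b′ : Branch m (i + suc e) (j + suc e)
              b′ = subst₂ (Branch m) (sym (+-suc i e)) (sym (+-suc j e)) (branch-tail b)
              choose : Agree m (s + suc e) (i + suc e) ×
                (SameBranch m (s + suc e) (s′ + suc e) (i + suc e) (j + suc e) ⊎
                 SameBranch m (s + suc e) (s′ + suc e) (j + suc e) (i + suc e)) → s ⊑ s′
              choose (a₁ , inj₁ sb) = linked i j b sb a₁
              choose (a₁ , inj₂ sb) = linked j i (branch-sym b) sb (agree-trans a₁ (proj₁ b′))

          result : s ⊑ s′
          result {x} Sx with w (s + n) ≟ w (s′ + n)
          ... | yes eq = same ag eq Sx
          -- The bound `e` leaves room for windows of length `n` that end with the branching factor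
          -- of length `suc m`.
          ... | no ne = branches (suc m) e >>= λ where
            (i , j , e≤i , e≤j , b) → through ne (i ∸ e) (j ∸ e)
              (subst₂ (Branch (suc m)) (sym (m∸n+n≡m e≤i)) (sym (m∸n+n≡m e≤j)) b) Sx

        run : ∀ m {s x} → S s x → S (m + s) (actList (letters w (s + n) m) x)
        run zero    Sx = Sx
        run (suc m) {s} {x} Sx = subst (λ z → S z (actList (letters w (s + n) (suc m)) x)) (+-suc m s)
          (run m {suc s} (forward Sx))

    -- Loops at the branching factor and invariant sets.

    InvariantUnder : (𝕊 : StateSpace) → (ℕ → StateSpace.State 𝕊) → List ℕ → List ℕ → Set₁
    InvariantUnder 𝕊 Q X Y = Σ (State → Set) λ S →
      Σ State S × (∀ {x} → S x → S (actList X x)) × (∀ {x} → S x → S (actList Y x)) ×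
      (∀ {x} → S x → ¬ ¬ (Σ ℕ λ k → Q k ≈ x))
      where open StateSpace 𝕊

    -- The words are fixed before the state space, so that one pair serves all moduli `p ^ K`.
    AlwaysInvariant : List ℕ → List ℕ → Set₁
    AlwaysInvariant X Y = ∀ 𝕊 Q → Follows 𝕊 Q → ¬ ¬ InvariantUnder 𝕊 Q X Y

    Loop : ℕ → ℕ → Set
    Loop i a = Agree n₀ i (a + i)

    module _ {i j a b : ℕ} (ij : Agree n₀ i j) (la : Loop i a) (lb : Loop j b)
             (𝕊 : StateSpace) (Q : ℕ → StateSpace.State 𝕊) (Q-step : Follows 𝕊 Q) where
      open StateSpace 𝕊
      open States 𝕊 Q Q-step

      -- Reading the first loop carries the set at `t′` to the set at `a + t′`; the two windows end
      -- with the same `n₀` letters, so `descent` leads back. The second loop acts likewise on the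
      -- set at `u′`, which equals the one at `t′` because `i` and `j` start the same factor.
      loops-invariant : ¬ ¬ InvariantUnder 𝕊 Q (letters w (i + n₀) a) (letters w (j + n₀) b)
      loops-invariant k = ¬¬-saturated λ { (s₀ , o , ℓ , o≤ℓ , sat) →
        uniformly-recurrent s₀ ℓ λ { (e , dense) →
        recurrent i (a + n₀) e λ { (t , e≤t , at) →
        recurrent j (b + n₀) e λ { (u , e≤u , au) →
          build s₀ o ℓ o≤ℓ sat e dense t e≤t at u e≤u au } } } }
        where
        build : ∀ s₀ o ℓ → o ≤ ℓ → Saturated s₀ o ℓ → ∀ e →
          (∀ s → Σ ℕ λ d → d + ℓ ≤ e × Agree ℓ (s + d) s₀) →
          ∀ t → e ≤ t → Agree (a + n₀) i t → ∀ u → e ≤ u → Agree (b + n₀) j u → ⊥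
        build s₀ o ℓ o≤ℓ sat e dense t e≤t at u e≤u au =
          k (S t′ , (Q (t′ + n) , return (t′ , agree-refl , ≈-refl)) ,
             loop {t′} {i} {a} t′e at la ,
             (λ Sx → local u′ t′ u→t (loop {u′} {j} {b} u′e au lb (local t′ u′ t→u Sx))) ,
             λ Sx → Sx >>= λ { (j , _ , q) → return (j + n , q) })
          where
          -- With this length the windows at `t ∸ e` and `u ∸ e` end with the factors of length `n₀`
          -- at `t` and `u`.
          n = e + n₀
          dense′ : ∀ s → Σ ℕ λ d → d + ℓ ≤ n × Agree ℓ (s + d) s₀
          dense′ s = let d , le , ag = dense s in d , ≤-trans le (m≤m+n e n₀) , ag

          open Local s₀ o ℓ n o≤ℓ sat dense′
          t′ = t ∸ e
          u′ = u ∸ e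
          t′e : t′ + e ≡ t
          t′e = m∸n+n≡m e≤t
          u′e : u′ + e ≡ u
          u′e = m∸n+n≡m e≤u

          local : ∀ s s′ → Agree n₀ (s + e) (s′ + e) → s ⊑ s′
          local = descent e n₀ refl ≤-refl

          t→u : Agree n₀ (t′ + e) (u′ + e)
          t→u = subst₂ (Agree n₀) (sym t′e) (sym u′e)
            (agree-trans (agree-sym (agree-take (m≤n+m n₀ a) at)) (agree-trans ij (agree-take (m≤n+m n₀ b) au)))
          u→t : Agree n₀ (u′ + e) (t′ + e)
          u→t = agree-sym t→u

          loop : ∀ {s i a} {t} → s + e ≡ t → Agree (a + n₀) i t → Loop i a →
            ∀ {x} → S s x → S s (actList (letters w (i + n₀) a) x)
          loop {s} {i} {a} refl at la {x} Sx = local (a + s) s back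
            (subst (λ L → S (a + s) (actList L x)) same-letters (run a Sx))
            where
            same-letters : letters w (s + n) a ≡ letters w (i + n₀) a
            same-letters = trans (cong (λ z → letters w z a) (sym (+-assoc s e n₀)))
              (letters-cong w (agree-sym (agree-drop n₀ (subst (λ z → Agree z i (s + e)) (+-comm a n₀) at))))
            back : Agree n₀ (a + s + e) (s + e)
            back = agree-trans (agree-sym (subst (Agree n₀ (i + a))
                (trans (+-comm (s + e) a) (sym (+-assoc a s e))) (agree-drop a at)))
              (agree-trans (subst (λ z → Agree n₀ z i) (+-comm a i) (agree-sym la)) (agree-take (m≤n+m n₀ a) at))

    -- The loops start right after two occurrences of the branching factor of length `n₀`, at its
    -- different continuations; this is where the distinct first letters come from.
    two-loops : ¬ ¬ (Σ ℕ λ i → Σ ℕ λ j → Σ ℕ λ a → Σ ℕ λ b → w i ≢ w j ×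
      AlwaysInvariant (letters w i (suc a)) (letters w j (suc b)))
    two-loops k = branches n₀ 0 λ { (i , j , _ , _ , ij , ne) →
      return-to i λ { (a , la) → return-to j λ { (b , lb) →
        k (i + n₀ , j + n₀ , a , b , ne , λ 𝕊 Q Q-step → loops-invariant ij la lb 𝕊 Q Q-step) } } }
      where
      return-to : ∀ i → ¬ ¬ (Σ ℕ λ a → Loop i (suc a))
      -- The bound `suc i` forces a strictly later return, so the loop is non-empty.
      return-to i = recurrent i n₀ (suc i) >>= λ where
        (t , i<t , ag) → return (t ∸ suc i , subst (Agree n₀ i)
          (sym (trans (sym (+-suc (t ∸ suc i) i)) (m∸n+n≡m i<t))) ag)

open Combinatorics

-- Divisibility and vectors modulo `m`.

module Arithmetic where
  import Data.Nat.Divisibility as ℕd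
  open import Data.Nat.Primality using (prime⇒nonZero; prime⇒nonTrivial; prime⇒irreducible; euclidsLemma)
  open import Data.Nat.Coprimality using (Coprime; coprime-Bézout)
  open import Data.Nat.GCD using (module Bézout)
  open import Data.Integer using (ℤ; +_; _+_; _*_; _-_; -_; ∣_∣)
  open import Data.Integer.Properties
  open import Data.Integer.DivMod using (_%ℕ_; _/ℕ_; n%ℕd<d; a≡a%ℕn+[a/ℕn]*n)
  import Data.Integer.Divisibility as ℤd
  open import Data.Integer.Divisibility.Signed
  open import Data.Integer.Tactic.RingSolver using (solve-∀)
  open import Data.Fin.Properties using () renaming (<⇒≢ to Fin-<⇒≢)

  ∣-resp : ∀ {m x y} → x ≡ y → m ∣ x → m ∣ y
  ∣-resp refl d = d

  ∣0 : ∀ {m} → m ∣ + 0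
  ∣0 = divides (+ 0) refl

  ∣-x-x : ∀ {m} x → m ∣ x - x
  ∣-x-x x = ∣-resp (sym (+-inverseʳ x)) ∣0

  *-mono-∣ : ∀ {a b c d} → a ∣ c → b ∣ d → a * b ∣ c * d
  *-mono-∣ {a} {b} (divides q refl) (divides r refl) = divides (q * r) (lemma q a r b)
    where
    lemma : ∀ q a r b → q * a * (r * b) ≡ q * r * (a * b)
    lemma = solve-∀

  cong-trans : ∀ {m} x y z → m ∣ x - y → m ∣ y - z → m ∣ x - z
  cong-trans x y z d e = ∣-resp (lemma x y z) (∣m∣n⇒∣m+n d e)
    where
    lemma : ∀ x y z → (x - y) + (y - z) ≡ x - z
    lemma = solve-∀

  cong-sym : ∀ {m} x y → m ∣ x - y → m ∣ y - x
  cong-sym x y d = ∣-resp (lemma x y) (∣m⇒∣-m d)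
    where
    lemma : ∀ x y → - (x - y) ≡ y - x
    lemma = solve-∀

  cong-%ℕ : ∀ m .{{_ : ℕ.NonZero m}} x y → x %ℕ m ≡ y %ℕ m → + m ∣ x - y
  cong-%ℕ m x y e = divides (x /ℕ m - y /ℕ m)
    (trans (cong₂ _-_ (a≡a%ℕn+[a/ℕn]*n x m)
      (trans (a≡a%ℕn+[a/ℕn]*n y m) (cong (λ r → + r + y /ℕ m * + m) (sym e))))
      (lemma (+ (x %ℕ m)) (x /ℕ m) (y /ℕ m) (+ m)))
    where
    lemma : ∀ r a b m → (r + a * m) - (r + b * m) ≡ (a - b) * m
    lemma = solve-∀

  residue : ∀ m .{{_ : ℕ.NonZero m}} → ℤ → Fin m
  residue m x = fromℕ< (n%ℕd<d x m)

  residue-inj : ∀ m .{{_ : ℕ.NonZero m}} x y → residue m x ≡ residue m y → + m ∣ x - y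
  residue-inj m x y e = cong-%ℕ m x y (fromℕ<-injective _ _ (n%ℕd<d x m) (n%ℕd<d y m) e)

  Vector : Set
  Vector = ℤ × ℤ

  Congruent : ℤ → Vector → Vector → Set
  Congruent m (x₁ , x₂) (y₁ , y₂) = (m ∣ x₁ - y₁) × (m ∣ x₂ - y₂)

  actV : ℕ → Vector → Vector
  actV a (x₁ , x₂) = x₂ , x₁ + + a * x₂

  modular : ∀ m .{{_ : ℕ.NonZero m}} → StateSpace
  modular m = record
    { State    = Vector
    ; _≈_      = Congruent (+ m)
    ; ≈-refl   = λ { {x₁ , x₂} → ∣-x-x x₁ , ∣-x-x x₂ }
    ; ≈-sym    = λ { {x₁ , x₂} {y₁ , y₂} (d , e) → cong-sym x₁ y₁ d , cong-sym x₂ y₂ e }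
    ; ≈-trans  = λ { {x₁ , x₂} {y₁ , y₂} {z₁ , z₂} (d , e) (d′ , e′) →
                   cong-trans x₁ y₁ z₁ d d′ , cong-trans x₂ y₂ z₂ e e′ }
    ; act      = actV
    ; act-cong = λ { a {x₁ , x₂} {y₁ , y₂} (d , e) → e ,
                   ∣-resp (lemma (+ a) x₁ x₂ y₁ y₂) (∣m∣n⇒∣m+n d (∣n⇒∣m*n (+ a) e)) }
    ; act-inj  = λ { a {x₁ , x₂} {y₁ , y₂} (e , f) →
                   ∣m+n∣n⇒∣m (∣-resp (sym (lemma (+ a) x₁ x₂ y₁ y₂)) f) (∣n⇒∣m*n (+ a) e) , e }
    ; size     = m ℕ.* m
    ; code     = λ { (x₁ , x₂) → combine (residue m x₁) (residue m x₂) }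
    ; code-inj = λ { {x₁ , x₂} {y₁ , y₂} e →
                   let e₁ , e₂ = combine-injective (residue m x₁) (residue m x₂) (residue m y₁) (residue m y₂) e
                   in residue-inj m x₁ y₁ e₁ , residue-inj m x₂ y₂ e₂ }
    }
    where
    lemma : ∀ a x₁ x₂ y₁ y₂ → (x₁ - y₁) + a * (x₂ - y₂) ≡ (x₁ + a * x₂) - (y₁ + a * y₂)
    lemma = solve-∀

  actL : List ℕ → Vector → Vector
  actL []      x = x
  actL (a ∷ L) x = actL L (actV a x)

  actL-++ : ∀ L L′ x → actL (L ++ L′) x ≡ actL L′ (actL L x)
  actL-++ []      L′ x = refl
  actL-++ (a ∷ L) L′ x = actL-++ L L′ (actV a x)

  actList-modular : ∀ m .{{_ : ℕ.NonZero m}} L x → StateSpace.actList (modular m) L x ≡ actL L x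
  actList-modular m []      x = refl
  actList-modular m (a ∷ L) x = actList-modular m L (actV a x)

  -- Matrices of words.

  record Matrix : Set where
    constructor matrix
    field a b c d : ℕ

  -- The first letter gives the rightmost matrix, as it acts first. The entries are natural numbers
  -- for the inequalities in `not-proportional`.
  matrixOf : List ℕ → Matrix
  matrixOf []      = matrix 1 0 0 1
  matrixOf (x ∷ L) = let matrix a b c d = matrixOf L in matrix b (a ℕ.+ x ℕ.* b) d (c ℕ.+ x ℕ.* d)

  _·_ : Matrix → Vector → Vector
  matrix a b c d · (y₁ , y₂) = + a * y₁ + + b * y₂ , + c * y₁ + + d * y₂

  actL-matrix : ∀ L y → actL L y ≡ matrixOf L · y
  actL-matrix []      (y₁ , y₂) = cong₂ _,_ (lemma₁ y₁ y₂) (lemma₂ y₁ y₂)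
    where
    lemma₁ : ∀ y₁ y₂ → y₁ ≡ + 1 * y₁ + + 0 * y₂
    lemma₁ y₁ y₂ = sym (trans (cong (_+ + 0) (*-identityˡ y₁)) (+-identityʳ y₁))
    lemma₂ : ∀ y₁ y₂ → y₂ ≡ + 0 * y₁ + + 1 * y₂
    lemma₂ y₁ y₂ = sym (trans (+-identityˡ (+ 1 * y₂)) (*-identityˡ y₂))
  actL-matrix (x ∷ L) (y₁ , y₂) = trans (actL-matrix L (y₂ , y₁ + + x * y₂))
    (cong₂ _,_ (entry a b) (entry c d))
    where
    open Matrix (matrixOf L)
    lemma : ∀ a b x y₁ y₂ → a * y₂ + b * (y₁ + x * y₂) ≡ b * y₁ + (a + x * b) * y₂
    lemma = solve-∀
    entry : ∀ a b → + a * y₂ + + b * (y₁ + + x * y₂) ≡ + b * y₁ + + (a ℕ.+ x ℕ.* b) * y₂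
    entry a b = trans (lemma (+ a) (+ b) (+ x) y₁ y₂)
      (cong (λ z → + b * y₁ + (+ a + z) * y₂) (sym (pos-* x b)))

  dot : Vector → Vector → ℤ
  dot (v₁ , v₂) (y₁ , y₂) = v₁ * y₁ + v₂ * y₂

  repeat : ℕ → List ℕ → List ℕ
  repeat zero    Z = []
  repeat (suc n) Z = repeat n Z ++ Z

  iter : List ℕ → ℕ → Vector → Vector
  iter Z zero    y = y
  iter Z (suc n) y = actL Z (iter Z n y)

  actL-repeat : ∀ n Z y → actL (repeat n Z) y ≡ iter Z n y
  actL-repeat zero    Z y = refl
  actL-repeat (suc n) Z y = trans (actL-++ (repeat n Z) Z y) (cong (actL Z) (actL-repeat n Z y))

  -- Cayley–Hamilton for Z − 1.
  module _ (Z : List ℕ) where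
    open Matrix (matrixOf Z)

    traceMinus detMinus : ℤ
    traceMinus = (+ a - + 1) + (+ d - + 1)
    detMinus   = (+ a - + 1) * (+ d - + 1) - + b * + c

    second-difference : ∀ v y →
      (dot v (actL Z (actL Z y)) - dot v (actL Z y)) - (dot v (actL Z y) - dot v y) ≡
      traceMinus * (dot v (actL Z y) - dot v y) - detMinus * dot v y
    second-difference v y rewrite actL-matrix Z (actL Z y) | actL-matrix Z y =
      lemma (+ a) (+ b) (+ c) (+ d) (proj₁ v) (proj₂ v) (proj₁ y) (proj₂ y)
      where
      lemma : ∀ a b c d v₁ v₂ y₁ y₂ →
        let z₁ = a * y₁ + b * y₂ ; z₂ = c * y₁ + d * y₂
            g₀ = v₁ * y₁ + v₂ * y₂ ; g₁ = v₁ * z₁ + v₂ * z₂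
            g₂ = v₁ * (a * z₁ + b * z₂) + v₂ * (c * z₁ + d * z₂)
        in (g₂ - g₁) - (g₁ - g₀) ≡
           ((a - + 1) + (d - + 1)) * (g₁ - g₀) - ((a - + 1) * (d - + 1) - b * c) * g₀
      lemma = solve-∀

  -- Linear growth under words close to the identity.

  linear-step : ∀ {m} x y a D n → m ∣ (x - y) - D → m ∣ y - (a + + n * D) → m ∣ x - (a + + suc n * D)
  linear-step {m} x y a D n d e = subst (λ z → m ∣ x - (a + z)) (sym (suc-* (+ n) D))
    (∣-resp (lemma x y a D (+ n * D)) (∣m∣n⇒∣m+n d e))
    where
    lemma : ∀ x y a D E → ((x - y) - D) + (y - (a + E)) ≡ x - (a + (D + E))
    lemma = solve-∀

  module _ {q P : ℤ} (g : ℕ → ℤ) {τ δ : ℤ} (q∣τ : q ∣ τ) (q∣δ : q ∣ δ)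
           (recurrence : ∀ n → (g (2 ℕ.+ n) - g (1 ℕ.+ n)) - (g (1 ℕ.+ n) - g n) ≡ τ * (g (1 ℕ.+ n) - g n) - δ * g n)
           (P∣g₀ : P ∣ g 0) (P∣Δ₀ : P ∣ g 1 - g 0) where

    -- By the recurrence a second difference combines multiples of `P` with coefficients divisible
    -- by `q`, so successive differences change only by multiples of `P * q`.
    almost-constant-difference : ∀ n → (P ∣ g n) × (P * q ∣ (g (suc n) - g n) - (g 1 - g 0))
    almost-constant-difference zero    = P∣g₀ , ∣-x-x (g 1 - g 0)
    almost-constant-difference (suc n) =
      ∣-resp (lemma₁ (g (suc n)) (g n)) (∣m∣n⇒∣m+n P∣gn P∣Δ) ,
      cong-trans (g (2 ℕ.+ n) - g (suc n)) (g (suc n) - g n) (g 1 - g 0)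
        (∣-resp (sym (recurrence n)) (∣m∣n⇒∣m-n (swap (*-mono-∣ q∣τ P∣Δ)) (swap (*-mono-∣ q∣δ P∣gn)))) close
      where
      IH = almost-constant-difference n
      P∣gn = proj₁ IH
      close = proj₂ IH
      lemma₁ : ∀ x y → y + (x - y) ≡ x
      lemma₁ = solve-∀
      lemma₂ : ∀ x y → (x - y) + y ≡ x
      lemma₂ = solve-∀
      swap : ∀ {z} → q * P ∣ z → P * q ∣ z
      swap {z} = subst (_∣ z) (*-comm q P)
      P∣Δ : P ∣ g (suc n) - g n
      P∣Δ = ∣-resp (lemma₂ (g (suc n) - g n) (g 1 - g 0))
        (∣m∣n⇒∣m+n (∣-trans (∣m⇒∣m*n q ∣-refl) close) P∣Δ₀)

    almost-linear : ∀ n → P * q ∣ g n - (g 0 + + n * (g 1 - g 0))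
    almost-linear zero    = ∣-resp (lemma (g 0) (g 1 - g 0)) ∣0
      where
      lemma : ∀ x y → + 0 ≡ x - (x + + 0 * y)
      lemma = solve-∀
    almost-linear (suc n) = linear-step (g (suc n)) (g n) (g 0) (g 1 - g 0) n
      (proj₂ (almost-constant-difference n)) (almost-linear n)

  NearIdentity : ℤ → List ℕ → Set
  NearIdentity q Z = ∀ y → Congruent q (actL Z y) y

  iter-near : ∀ {q Z} → NearIdentity q Z → ∀ n y → Congruent q (iter Z n y) y
  iter-near near zero    (y₁ , y₂) = ∣-x-x y₁ , ∣-x-x y₂
  iter-near {q} {Z} near (suc n) (y₁ , y₂) with iter Z n (y₁ , y₂) | iter-near {q} {Z} near n (y₁ , y₂)
  ... | x | d , e =
    cong-trans (proj₁ (actL Z x)) (proj₁ x) y₁ (proj₁ (near x)) d ,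
    cong-trans (proj₂ (actL Z x)) (proj₂ x) y₂ (proj₂ (near x)) e

  repeat-near : ∀ {q Z} n → NearIdentity q Z → NearIdentity q (repeat n Z)
  repeat-near {q} {Z} n near y = subst (λ x → Congruent q x y) (sym (actL-repeat n Z y)) (iter-near near n y)

  module _ {q : ℤ} (Z : List ℕ) where
    open Matrix (matrixOf Z)

    column₁ : Congruent q (actL Z (+ 1 , + 0)) (+ 1 , + 0) → (q ∣ + a - + 1) × (q ∣ + c)
    column₁ cong₁ with subst (λ x → Congruent q x (+ 1 , + 0)) (actL-matrix Z (+ 1 , + 0)) cong₁
    ... | e₁ , e₂ = ∣-resp (lemma₁ (+ a) (+ b)) e₁ , ∣-resp (lemma₂ (+ c) (+ d)) e₂
      where
      lemma₁ : ∀ a b → (a * + 1 + b * + 0) - + 1 ≡ a - + 1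
      lemma₁ = solve-∀
      lemma₂ : ∀ a b → (a * + 1 + b * + 0) - + 0 ≡ a
      lemma₂ = solve-∀

    column₂ : Congruent q (actL Z (+ 0 , + 1)) (+ 0 , + 1) → (q ∣ + b) × (q ∣ + d - + 1)
    column₂ cong₂ with subst (λ x → Congruent q x (+ 0 , + 1)) (actL-matrix Z (+ 0 , + 1)) cong₂
    ... | e₁ , e₂ = ∣-resp (lemma₂ (+ a) (+ b)) e₁ , ∣-resp (lemma₁ (+ c) (+ d)) e₂
      where
      lemma₁ : ∀ a b → (a * + 0 + b * + 1) - + 1 ≡ b - + 1
      lemma₁ = solve-∀
      lemma₂ : ∀ a b → (a * + 0 + b * + 1) - + 0 ≡ b
      lemma₂ = solve-∀

    near-of-basis : Congruent q (actL Z (+ 1 , + 0)) (+ 1 , + 0) →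
                    Congruent q (actL Z (+ 0 , + 1)) (+ 0 , + 1) → NearIdentity q Z
    near-of-basis cong₁ cong₂ (y₁ , y₂) = subst (λ x → Congruent q x (y₁ , y₂)) (sym (actL-matrix Z (y₁ , y₂)))
      ( ∣-resp (lemma₁ (+ a) (+ b) y₁ y₂) (∣m∣n⇒∣m+n (∣m⇒∣m*n y₁ (proj₁ (column₁ cong₁))) (∣m⇒∣m*n y₂ (proj₁ (column₂ cong₂))))
      , ∣-resp (lemma₂ (+ c) (+ d) y₁ y₂) (∣m∣n⇒∣m+n (∣m⇒∣m*n y₁ (proj₂ (column₁ cong₁))) (∣m⇒∣m*n y₂ (proj₂ (column₂ cong₂)))))
      where
      lemma₁ : ∀ a b y₁ y₂ → (a - + 1) * y₁ + b * y₂ ≡ (a * y₁ + b * y₂) - y₁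
      lemma₁ = solve-∀
      lemma₂ : ∀ c d y₁ y₂ → c * y₁ + (d - + 1) * y₂ ≡ (c * y₁ + d * y₂) - y₂
      lemma₂ = solve-∀

    module _ (near : NearIdentity q Z) where

      ∣traceMinus : q ∣ traceMinus Z
      ∣traceMinus = ∣m∣n⇒∣m+n (proj₁ (column₁ (near _))) (proj₂ (column₂ (near _)))

      ∣detMinus : q ∣ detMinus Z
      ∣detMinus = ∣m∣n⇒∣m-n (∣m⇒∣m*n _ (proj₁ (column₁ (near _)))) (∣m⇒∣m*n _ (proj₁ (column₂ (near _))))

  -- Valuations and congruences for a prime.

  module PrimePowers (p : ℕ) (pp : Prime p) where

    instance
      p≢0 : ℕ.NonZero p
      p≢0 = prime⇒nonZero pp

    p^≢0 : ∀ e → ℕ.NonZero (p ℕ.^ e)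
    p^≢0 e = ℕₚ.m^n≢0 p e

    pw : ℕ → ℤ
    pw e = + (p ℕ.^ e)

    pw-+ : ∀ m n → pw (m ℕ.+ n) ≡ pw m * pw n
    pw-+ m n = trans (cong +_ (ℕₚ.^-distribˡ-+-* p m n)) (pos-* (p ℕ.^ m) (p ℕ.^ n))

    pw-suc : ∀ n → pw (suc n) ≡ + p * pw n
    pw-suc n = pos-* p (p ℕ.^ n)

    pw-mono : ∀ {m n} → m ℕ.≤ n → pw m ∣ pw n
    pw-mono {m} {n} m≤n = ∣-resp (trans (sym (pw-+ m (n ℕ.∸ m))) (cong pw (ℕₚ.m+[n∸m]≡n m≤n)))
      (∣m⇒∣m*n (pw (n ℕ.∸ m)) ∣-refl)

    pw-∣ : ∀ {m n z} → m ℕ.≤ n → pw n ∣ z → pw m ∣ z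
    pw-∣ m≤n = ∣-trans (pw-mono m≤n)

    1<p : 1 ℕ.< p
    1<p = ℕ.nonTrivial⇒n>1 p {{prime⇒nonTrivial pp}}

    n<p^n : ∀ n → n ℕ.< p ℕ.^ n
    n<p^n zero    = s≤s z≤n
    n<p^n (suc n) = ℕₚ.≤-<-trans (n<p^n n) (ℕₚ.^-monoʳ-< p 1<p (ℕₚ.n<1+n n))

    -- The cut-off `k` keeps the search finite when `z` is zero.
    valuation : ∀ z k → (Σ ℕ λ h → h ℕ.< k × (pw h ∣ z) × ¬ (pw (suc h) ∣ z)) ⊎ (pw k ∣ z)
    valuation z zero    = inj₂ (divides z (sym (*-identityʳ z)))
    valuation z (suc k) with valuation z k
    ... | inj₁ (h , h<k , d , ¬d) = inj₁ (h , ℕₚ.m≤n⇒m≤1+n h<k , d , ¬d)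
    ... | inj₂ d with pw (suc k) ∣? z
    ...   | yes d′ = inj₂ d′
    ...   | no ¬d′ = inj₁ (k , ℕₚ.≤-refl , d , ¬d′)

    euclid : ∀ a f → + p ∣ a * f → (+ p ∣ a) ⊎ (+ p ∣ f)
    euclid a f d with euclidsLemma ∣ a ∣ ∣ f ∣ pp (subst (p ℕd.∣_) (abs-* a f) (∣⇒∣ᵤ d))
    ... | inj₁ e = inj₁ (∣ᵤ⇒∣ e)
    ... | inj₂ e = inj₂ (∣ᵤ⇒∣ e)

    private
      cancel-p : ∀ {n} {x y : ℤ} → pw (suc n) ∣ x → x ≡ + p * y → pw n ∣ y
      cancel-p {n} d e = *-cancelˡ-∣ (+ p) (subst₂ _∣_ (pw-suc n) e d)

      multiply-p : ∀ {n} y → pw n ∣ y → pw (suc n) ∣ y * + p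
      multiply-p {n} y d = subst₂ _∣_ (sym (pw-suc n)) (*-comm (+ p) y) (*-monoʳ-∣ (+ p) d)

      move : ∀ a q p → a * (q * p) ≡ p * (a * q)
      move = solve-∀

      move′ : ∀ q p f → (q * p) * f ≡ p * (q * f)
      move′ = solve-∀

    prime-power-cancel : ∀ n {a} f → ¬ (+ p ∣ a) → pw n ∣ a * f → pw n ∣ f
    prime-power-cancel zero        f _   _ = divides f (sym (*-identityʳ f))
    prime-power-cancel (suc n) {a} f p∤a d with euclid a f (∣-trans (∣-resp (sym (pw-suc n)) (∣m⇒∣m*n (pw n) ∣-refl)) d)
    ... | inj₁ p∣a = ⊥-elim (p∤a p∣a)
    ... | inj₂ (divides q refl) = multiply-p {n} q (prime-power-cancel n q p∤a (cancel-p {n} d (move a q (+ p))))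

    prime-power-split : ∀ m n a f → pw (m ℕ.+ n) ∣ a * f → (pw (suc m) ∣ a) ⊎ (pw n ∣ f)
    prime-power-split m n a f d = by-cases m d (+ p ∣? a)
      where
      by-cases : ∀ m → pw (m ℕ.+ n) ∣ a * f → Dec (+ p ∣ a) → (pw (suc m) ∣ a) ⊎ (pw n ∣ f)
      by-cases m       d (no p∤a)  = inj₂ (pw-∣ (ℕₚ.m≤n+m n m) (prime-power-cancel (m ℕ.+ n) f p∤a d))
      by-cases zero    d (yes p∣a) = inj₁ (subst (_∣ a) (cong +_ (sym (ℕₚ.^-identityʳ p))) p∣a)
      by-cases (suc m) d (yes (divides q a≡qp)) = lift (prime-power-split m n q f
        (cancel-p {m ℕ.+ n} d (trans (cong (_* f) a≡qp) (move′ q (+ p) f))))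
        where
        lift : (pw (suc m) ∣ q) ⊎ (pw n ∣ f) → (pw (suc (suc m)) ∣ a) ⊎ (pw n ∣ f)
        lift (inj₁ e) = inj₁ (∣-resp (sym a≡qp) (multiply-p {suc m} q e))
        lift (inj₂ e) = inj₂ e

    -- The solution is a natural number because it will count iterations of a word. With `t` a
    -- negated inverse of `u` modulo `p`, the residue of `g * t` works.
    solve-congruence : ∀ {u} → ¬ (+ p ∣ u) → ∀ g → Σ ℕ λ c → + p ∣ g + + c * u
    solve-congruence {u} p∤u g = c , ∣-resp eq (∣m∣n⇒∣m-n (∣n⇒∣m*n g (proj₂ inverse)) (∣n⇒∣m*n ((g * t) /ℕ p * u) ∣-refl))
      where
      coprime : Coprime p ∣ u ∣
      coprime (d∣p , d∣u) with prime⇒irreducible pp d∣p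
      ... | inj₁ e    = e
      ... | inj₂ refl = ⊥-elim (p∤u (∣ᵤ⇒∣ d∣u))

      inverse : Σ ℤ λ t → + p ∣ + 1 + t * u
      inverse with m∣∣m∣ {u} | coprime-Bézout coprime
      ... | divides k ∣u∣≡ku | Bézout.+- x y eq = + y * k , divides (+ x)
        (trans (cong (λ z → + 1 + z) (trans (*-assoc (+ y) k u) (cong (+ y *_) (sym ∣u∣≡ku))))
          (trans (cong (λ z → + 1 + z) (sym (pos-* y ∣ u ∣))) (trans (cong +_ eq) (pos-* x p))))
      ... | divides k ∣u∣≡ku | Bézout.-+ x y eq = - (+ y * k) , divides (- + x)
        (lemma₂ (+ x) (+ y * k) (+ p) u (trans (cong (λ z → + 1 + z) (sym (pos-* x p)))
          (trans (cong +_ eq) (trans (pos-* y ∣ u ∣) (trans (cong (+ y *_) ∣u∣≡ku) (sym (*-assoc (+ y) k u)))))))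
        where
        lemma₁ : ∀ x p → + 1 + - (+ 1 + x * p) ≡ - x * p
        lemma₁ = solve-∀
        lemma₃ : ∀ t u → + 1 + - t * u ≡ + 1 + - (t * u)
        lemma₃ = solve-∀
        lemma₂ : ∀ x t p u → + 1 + x * p ≡ t * u → + 1 + - t * u ≡ - x * p
        lemma₂ x t p u e = trans (lemma₃ t u) (trans (cong (λ z → + 1 + - z) (sym e)) (lemma₁ x p))

      t : ℤ
      t = proj₁ inverse
      c : ℕ
      c = (g * t) %ℕ p
      lemma : ∀ g t u c q p → g * t ≡ c + q * p → g * (+ 1 + t * u) - q * u * p ≡ g + c * u
      lemma g t u c q p e = trans (l₁ g t u q p) (trans (cong (λ z → g + z * u - q * u * p) e) (l₂ g c u q p))
        where
        l₁ : ∀ g t u q p → g * (+ 1 + t * u) - q * u * p ≡ g + (g * t) * u - q * u * p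
        l₁ = solve-∀
        l₂ : ∀ g c u q p → g + (c + q * p) * u - q * u * p ≡ g + c * u
        l₂ = solve-∀
      eq : g * (+ 1 + t * u) - (g * t) /ℕ p * u * + p ≡ g + + c * u
      eq = lemma g t u (+ c) ((g * t) /ℕ p) (+ p) (a≡a%ℕn+[a/ℕn]*n (g * t) p)

  -- Hensel lifting along an orbit.

  module Climbing (p : ℕ) (pp : Prime p) (S : Vector → Set) where
    open PrimePowers p pp

    -- Hensel lifting of v·y = 0 along the orbit of y under a word, whose step has valuation exactly m.
    record Stage (v : Vector) (m : ℕ) : Set where
      field
        word   : List ℕ
        closed : ∀ {y} → S y → S (actL word y)
        near   : NearIdentity (pw 2) word
        point  : Vector
        inside : S point
        value  : pw m ∣ dot v point
        change : pw m ∣ dot v (actL word point) - dot v point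
        exact  : ¬ (pw (suc m) ∣ dot v (actL word point) - dot v point)

    iter-closed : ∀ {Z} → (∀ {y} → S y → S (actL Z y)) → ∀ n {y} → S y → S (iter Z n y)
    iter-closed closed zero    Sy = Sy
    iter-closed closed (suc n) Sy = closed (iter-closed closed n Sy)

    -- Along the orbit the values of `dot v` are linear modulo `P * q`, with step `Δ` of valuation
    -- exactly `m`. A suitable number `c` of steps gains one factor `p` in the value. The `p`-fold
    -- word has step close to `p` times `Δ`; as `P * q` is `pw (m + 2)`, its valuation is seen to be
    -- exactly `m + 1`.
    climb : ∀ {v m} → Stage v m → Stage v (suc m)
    climb {v} {m} st = record
      { word   = repeat p word
      ; closed = λ {y} Sy → subst S (sym (actL-repeat p word y)) (iter-closed {word} closed p Sy)
      ; near   = repeat-near {Z = word} p near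
      ; point  = y′
      ; inside = iter-closed {word} closed c inside
      ; value  = value′
      ; change = ∣-resp (cong (λ z → dot v z - h 0) (sym (actL-repeat p word y′))) change′
      ; exact  = λ d → exact′ (∣-resp (cong (λ z → dot v z - h 0) (actL-repeat p word y′)) d)
      }
      where
      open Stage st
      q P : ℤ
      q = pw 2
      P = pw m

      g : ℕ → ℤ
      g n = dot v (iter word n point)

      Pq : P * q ≡ pw (suc (suc m))
      Pq = trans (sym (pw-+ m 2)) (cong pw (ℕₚ.+-comm m 2))

      P∣Pq : pw (suc m) ∣ P * q
      P∣Pq = ∣-resp (sym Pq) (pw-mono (ℕₚ.n≤1+n (suc m)))

      sequence : ∀ y → pw m ∣ dot v y → pw m ∣ dot v (actL word y) - dot v y →
        ∀ n → P * q ∣ dot v (iter word n y) - (dot v y + + n * (dot v (actL word y) - dot v y))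
      sequence y = almost-linear (λ n → dot v (iter word n y)) (∣traceMinus word near) (∣detMinus word near)
        (λ n → second-difference word v (iter word n y))

      u : ℤ
      u = quotient change

      Δ : ℤ
      Δ = g 1 - g 0

      Δ≡ : Δ ≡ u * P
      Δ≡ = _∣_.equality change

      p∤u : ¬ (+ p ∣ u)
      p∤u (divides r e) = exact (divides r (trans Δ≡ (trans (cong (_* P) e)
        (trans (*-assoc r (+ p) P) (cong (r *_) (sym (pw-suc m)))))))

      solution : Σ ℕ λ c → + p ∣ quotient value + + c * u
      solution = solve-congruence p∤u (quotient value)

      c : ℕ
      c = proj₁ solution

      y′ : Vector
      y′ = iter word c point

      h : ℕ → ℤ
      h n = dot v (iter word n y′)

      near-c : (P ∣ g c) × (P * q ∣ (h 1 - h 0) - Δ)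
      near-c = almost-constant-difference g (∣traceMinus word near) (∣detMinus word near)
        (λ n → second-difference word v (iter word n point)) value change c

      value′ : pw (suc m) ∣ h 0
      value′ = ∣-resp (lemma (h 0) (g 0 + + c * Δ)) (∣m∣n⇒∣m+n
        (∣-trans P∣Pq (sequence point value change c))
        (∣-resp (combination (g 0) Δ (quotient value) u P (+ c) (_∣_.equality value) Δ≡)
          (subst (_∣ (quotient value + + c * u) * P) (sym (pw-suc m)) (*-monoˡ-∣ P (proj₂ solution)))))
        where
        lemma : ∀ x y → (x - y) + y ≡ x
        lemma = solve-∀
        expand : ∀ a u P c → (a + c * u) * P ≡ a * P + c * (u * P)
        expand = solve-∀
        combination : ∀ x D a u P c → x ≡ a * P → D ≡ u * P → (a + c * u) * P ≡ x + c * D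
        combination x D a u P c e f = trans (expand a u P c) (cong₂ (λ s t → s + c * t) (sym e) (sym f))

      Δ′-close : P * q ∣ (h 1 - h 0) - Δ
      Δ′-close = proj₂ near-c

      lemma-sum : ∀ x y → (x - y) + y ≡ x
      lemma-sum = solve-∀

      P∣Δ′ : P ∣ h 1 - h 0
      P∣Δ′ = ∣-resp (lemma-sum (h 1 - h 0) Δ) (∣m∣n⇒∣m+n (∣-trans (∣m⇒∣m*n q ∣-refl) Δ′-close) change)

      linear : P * q ∣ h p - (h 0 + + p * (h 1 - h 0))
      linear = sequence y′ (proj₁ near-c) P∣Δ′ p

      rearrange : ∀ x y z → (x - (y + z)) + z ≡ x - y
      rearrange = solve-∀

      rearrange′ : ∀ x y z → (x - y) - (x - (y + z)) ≡ z
      rearrange′ = solve-∀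

      change′ : pw (suc m) ∣ h p - h 0
      change′ = ∣-resp (rearrange (h p) (h 0) (+ p * (h 1 - h 0)))
        (∣m∣n⇒∣m+n (∣-trans P∣Pq linear) (subst (_∣ + p * (h 1 - h 0)) (sym (pw-suc m)) (*-monoʳ-∣ (+ p) P∣Δ′)))

      flip : ∀ x y → x - (x - y) ≡ y
      flip = solve-∀

      exact′ : ¬ (pw (suc (suc m)) ∣ h p - h 0)
      exact′ d = exact (∣-resp (flip (h 1 - h 0) Δ) (∣m∣n⇒∣m-n pΔ′ (∣-trans P∣Pq Δ′-close)))
        where
        pΔ′ : pw (suc m) ∣ h 1 - h 0
        pΔ′ = *-cancelˡ-∣ (+ p) (subst (_∣ + p * (h 1 - h 0)) (pw-suc (suc m))
          (∣-resp (rearrange′ (h p) (h 0) (+ p * (h 1 - h 0))) (∣m∣n⇒∣m-n d (subst (_∣ h p - (h 0 + + p * (h 1 - h 0))) Pq linear))))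

    climb-+ : ∀ {v m} k → Stage v m → Stage v (k ℕ.+ m)
    climb-+ zero    st = st
    climb-+ (suc k) st = climb (climb-+ k st)

  -- Pigeonhole (Dirichlet): the (M+1)² values a y₁ + b y₂ with 0 ≤ a , b ≤ M repeat modulo M².
  dirichlet : ∀ M .{{_ : ℕ.NonZero (M ℕ.* M)}} y → Σ ℤ λ a → Σ ℤ λ b → ¬ (a ≡ + 0 × b ≡ + 0) ×
    ∣ a ∣ ℕ.≤ M × ∣ b ∣ ℕ.≤ M × (+ (M ℕ.* M) ∣ dot (a , b) y)
  dirichlet M (y₁ , y₂) = difference (pigeonhole (ℕₚ.*-mono-< (ℕₚ.n<1+n M) (ℕₚ.n<1+n M)) λ i →
      residue (M ℕ.* M) (value (remQuot {suc M} (suc M) i)))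
    where
    value : Fin (suc M) × Fin (suc M) → ℤ
    value (a , b) = + toℕ a * y₁ + + toℕ b * y₂

    bound : (a b : Fin (suc M)) → ∣ + toℕ a - + toℕ b ∣ ℕ.≤ M
    bound a b = subst (λ z → ∣ z ∣ ℕ.≤ M) (sym (m-n≡m⊖n (toℕ a) (toℕ b)))
      (ℕₚ.≤-trans (∣m⊝n∣≤m⊔n (toℕ a) (toℕ b)) (ℕₚ.⊔-lub (ℕ.s≤s⁻¹ (toℕ<n a)) (ℕ.s≤s⁻¹ (toℕ<n b))))

    equal : (a b : Fin (suc M)) → + toℕ a - + toℕ b ≡ + 0 → a ≡ b
    equal a b e = toℕ-injective (+-injective (i-j≡0⇒i≡j (+ toℕ a) (+ toℕ b) e))

    lemma : ∀ a b c d y₁ y₂ → (a * y₁ + b * y₂) - (c * y₁ + d * y₂) ≡ (a - c) * y₁ + (b - d) * y₂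
    lemma = solve-∀

    difference : (Σ _ λ i → Σ _ λ j → i Fin.< j × residue (M ℕ.* M) (value (remQuot {suc M} (suc M) i)) ≡
        residue (M ℕ.* M) (value (remQuot {suc M} (suc M) j))) → _
    difference (i , j , i<j , e) =
      + toℕ a - + toℕ c , + toℕ b - + toℕ d ,
      (λ { (e₁ , e₂) → Fin-<⇒≢ i<j (trans (sym (combine-remQuot {suc M} (suc M) i))
        (trans (cong₂ combine (equal a c e₁) (equal b d e₂)) (combine-remQuot {suc M} (suc M) j))) }) ,
      bound a c , bound b d ,
      ∣-resp (lemma (+ toℕ a) (+ toℕ b) (+ toℕ c) (+ toℕ d) y₁ y₂)
        (residue-inj (M ℕ.* M) (value (a , b)) (value (c , d)) e)
      where
      a = proj₁ (remQuot {suc M} (suc M) i)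
      b = proj₂ (remQuot {suc M} (suc M) i)
      c = proj₁ (remQuot {suc M} (suc M) j)
      d = proj₂ (remQuot {suc M} (suc M) j)

  -- Finite order of words modulo `m`.

  iter-+ : ∀ Z m n y → iter Z (m ℕ.+ n) y ≡ iter Z m (iter Z n y)
  iter-+ Z zero    n y = refl
  iter-+ Z (suc m) n y = cong (actL Z) (iter-+ Z m n y)

  module _ (m : ℕ) .{{_ : ℕ.NonZero m}} where
    open StateSpace (modular m) using (_≈_; act-inj; code; code-inj; size)

    actL-inj : ∀ Z {x y} → actL Z x ≈ actL Z y → x ≈ y
    actL-inj []      e = e
    actL-inj (a ∷ Z) {x} {y} e = act-inj a {x} {y} (actL-inj Z e)

    iter-inj : ∀ Z n {x y} → iter Z n x ≈ iter Z n y → x ≈ y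
    iter-inj Z zero    e = e
    iter-inj Z (suc n) e = iter-inj Z n (actL-inj Z e)

    -- By pigeonhole two powers of `Z` agree on both basis vectors modulo `m`. Injectivity cancels
    -- the smaller power, and linearity extends the result to all vectors.
    finite-order : ∀ Z → Σ ℕ λ n → NearIdentity (+ m) (repeat (suc n) Z)
    finite-order Z = from-repetition (pigeonhole (ℕₚ.n<1+n (size ℕ.* size)) λ i →
        combine (code (iter Z (toℕ i) e₁)) (code (iter Z (toℕ i) e₂)))
      where
      e₁ e₂ : Vector
      e₁ = + 1 , + 0
      e₂ = + 0 , + 1

      from-repetition : (Σ _ λ i → Σ _ λ j → i Fin.< j ×
        combine (code (iter Z (toℕ i) e₁)) (code (iter Z (toℕ i) e₂)) ≡
        combine (code (iter Z (toℕ j) e₁)) (code (iter Z (toℕ j) e₂))) → Σ ℕ λ n → NearIdentity (+ m) (repeat (suc n) Z)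
      from-repetition (i , j , i<j , e) = n , near-of-basis (repeat (suc n) Z) (fixed e₁ (proj₁ both)) (fixed e₂ (proj₂ both))
        where
        t = toℕ i
        n = toℕ j ℕ.∸ suc t
        t+n : t ℕ.+ suc n ≡ toℕ j
        t+n = trans (ℕₚ.+-suc t n) (ℕₚ.m+[n∸m]≡n i<j)
        both = combine-injective (code (iter Z t e₁)) (code (iter Z t e₂))
          (code (iter Z (toℕ j) e₁)) (code (iter Z (toℕ j) e₂)) e
        fixed : ∀ v → code (iter Z t v) ≡ code (iter Z (toℕ j) v) → actL (repeat (suc n) Z) v ≈ v
        fixed v c = iter-inj Z t (subst (_≈ iter Z t v)
          (trans (cong (λ k → iter Z k v) (sym t+n))
            (trans (iter-+ Z t (suc n) v) (cong (iter Z t) (sym (actL-repeat (suc n) Z v)))))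
          (code-inj {iter Z (toℕ j) v} {iter Z t v} (sym c)))

  -- Positivity and the fixed-point forms of words.

  Reduced : Matrix → Set
  Reduced (matrix a b c d) = 0 ℕ.< b × 0 ℕ.< c × 0 ℕ.< d × a ℕ.≤ b × c ℕ.≤ d

  private
    NonDegenerate : Matrix → Set
    NonDegenerate (matrix a b c d) = 0 ℕ.< a ℕ.+ b × 0 ℕ.< d

  nonDegenerate : ∀ {L} → All (1 ℕ.≤_) L → NonDegenerate (matrixOf L)
  -- A new first letter `x` turns columns `k₁`, `k₂` into `k₂`, `k₁ + x k₂`, so the second column
  -- dominates as soon as the word is non-empty.
  reduced : ∀ {x L} → 1 ℕ.≤ x → All (1 ℕ.≤_) L → Reduced (matrixOf (x ∷ L))

  nonDegenerate []         = s≤s z≤n , s≤s z≤n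
  nonDegenerate {_ ∷ L} (1≤x ∷ ps) with reduced 1≤x ps
  ... | 0<b , _ , 0<d , _ , _ = ℕₚ.<-≤-trans 0<b (ℕₚ.m≤n+m _ (Matrix.b (matrixOf L))) , 0<d

  reduced {x} {L} 1≤x ps with matrixOf L | nonDegenerate ps
  ... | matrix a b c d | 0<a+b , 0<d =
    ℕₚ.<-≤-trans 0<a+b (ℕₚ.+-monoʳ-≤ a (y≤xy b)) , 0<d ,
    ℕₚ.<-≤-trans 0<d (ℕₚ.≤-trans (y≤xy d) (ℕₚ.m≤n+m _ c)) ,
    ℕₚ.≤-trans (y≤xy b) (ℕₚ.m≤n+m _ a) , ℕₚ.≤-trans (y≤xy d) (ℕₚ.m≤n+m _ c)
    where
    y≤xy : ∀ y → y ℕ.≤ x ℕ.* y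
    y≤xy y = subst (ℕ._≤ x ℕ.* y) (ℕₚ.*-identityˡ y) (ℕₚ.*-monoˡ-≤ y 1≤x)

  module _ where
    open import Data.Nat.Tactic.RingSolver using () renaming (solve-∀ to solveℕ)
    open import Data.Nat using (_≤_; _<_) renaming (_+_ to _⊕_; _*_ to _⊗_)

    -- The fixed-point form b + (d − a) z − c z² is ≤ 0 at z = y for the word starting with x < y,
    -- and > 0 there for the word starting with y, so the two forms are not proportional.
    not-proportional : ∀ {x y} N N′ → x < y → Reduced N → Reduced N′ → 1 ≤ x →
      let matrix n₁ n₂ n₃ n₄ = N ; matrix m₁ m₂ m₃ m₄ = N′
          a = n₂ ; b = n₁ ⊕ x ⊗ n₂ ; c = n₄ ; d = n₃ ⊕ x ⊗ n₄
          a′ = m₂ ; b′ = m₁ ⊕ y ⊗ m₂ ; c′ = m₄ ; d′ = m₃ ⊕ y ⊗ m₄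
      in b′ ⊗ c ≡ b ⊗ c′ → b′ ⊗ d ⊕ b ⊗ a′ ≡ b ⊗ d′ ⊕ b′ ⊗ a → ⊥
    not-proportional {x} {y} (matrix n₁ n₂ n₃ n₄) (matrix m₁ m₂ m₃ m₄) x<y
        (0<n₂ , _ , _ , n₁≤n₂ , n₃≤n₄) (_ , 0<m₃ , _) 1≤x e₁ e₂ =
      ℕₚ.<⇒≱ 0<bΦ (ℕₚ.+-cancelʳ-≤ rest _ 0 (begin
        b ⊗ (m₁ ⊕ y ⊗ m₃) ⊕ (b ⊗ a′ ⊗ y ⊕ b ⊗ c′ ⊗ (y ⊗ y) ⊕ b′ ⊗ a ⊗ y) ≡⟨ identity₁ b m₁ m₂ m₃ m₄ y a ⟩
        b ⊗ b′ ⊕ (b ⊗ d′ ⊕ b′ ⊗ a) ⊗ y      ≡⟨ cong (λ z → b ⊗ b′ ⊕ z ⊗ y) (sym e₂) ⟩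
        b ⊗ b′ ⊕ (b′ ⊗ d ⊕ b ⊗ a′) ⊗ y      ≡⟨ identity₂ b b′ d a′ y ⟩
        b′ ⊗ (b ⊕ d ⊗ y) ⊕ b ⊗ a′ ⊗ y       ≤⟨ ℕₚ.+-monoˡ-≤ (b ⊗ a′ ⊗ y)
                                                 (ℕₚ.*-monoʳ-≤ b′ (ℕₚ.+-mono-≤ b≤ya (ℕₚ.*-monoˡ-≤ y d≤yc))) ⟩
        b′ ⊗ (y ⊗ a ⊕ y ⊗ c ⊗ y) ⊕ b ⊗ a′ ⊗ y ≡⟨ identity₃ b′ y a c b a′ ⟩
        b ⊗ a′ ⊗ y ⊕ b′ ⊗ c ⊗ (y ⊗ y) ⊕ b′ ⊗ a ⊗ y ≡⟨ cong (λ z → b ⊗ a′ ⊗ y ⊕ z ⊗ (y ⊗ y) ⊕ b′ ⊗ a ⊗ y) e₁ ⟩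
        rest ∎))
      where
      open ℕₚ.≤-Reasoning
      a = n₂
      b = n₁ ⊕ x ⊗ n₂
      c = n₄
      d = n₃ ⊕ x ⊗ n₄
      a′ = m₂
      b′ = m₁ ⊕ y ⊗ m₂
      c′ = m₄
      d′ = m₃ ⊕ y ⊗ m₄
      rest = b ⊗ a′ ⊗ y ⊕ b ⊗ c′ ⊗ (y ⊗ y) ⊕ b′ ⊗ a ⊗ y
      b≤ya : b ≤ y ⊗ a
      b≤ya = ℕₚ.≤-trans (ℕₚ.+-monoˡ-≤ (x ⊗ n₂) n₁≤n₂) (ℕₚ.*-monoˡ-≤ n₂ x<y)
      d≤yc : d ≤ y ⊗ c
      d≤yc = ℕₚ.≤-trans (ℕₚ.+-monoˡ-≤ (x ⊗ n₄) n₃≤n₄) (ℕₚ.*-monoˡ-≤ n₄ x<y)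
      0<bΦ : 0 < b ⊗ (m₁ ⊕ y ⊗ m₃)
      0<bΦ = ℕₚ.*-mono-≤ {1} {b} {1}
        (ℕₚ.≤-trans (ℕₚ.*-mono-≤ 1≤x 0<n₂) (ℕₚ.m≤n+m _ n₁))
        (ℕₚ.≤-trans (ℕₚ.*-mono-≤ (ℕₚ.≤-trans (s≤s z≤n) x<y) 0<m₃) (ℕₚ.m≤n+m _ m₁))
      identity₁ : ∀ b m₁ m₂ m₃ m₄ y a →
        b ⊗ (m₁ ⊕ y ⊗ m₃) ⊕ (b ⊗ m₂ ⊗ y ⊕ b ⊗ m₄ ⊗ (y ⊗ y) ⊕ (m₁ ⊕ y ⊗ m₂) ⊗ a ⊗ y) ≡
        b ⊗ (m₁ ⊕ y ⊗ m₂) ⊕ (b ⊗ (m₃ ⊕ y ⊗ m₄) ⊕ (m₁ ⊕ y ⊗ m₂) ⊗ a) ⊗ y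
      identity₁ = solveℕ
      identity₂ : ∀ b b′ d a′ y → b ⊗ b′ ⊕ (b′ ⊗ d ⊕ b ⊗ a′) ⊗ y ≡ b′ ⊗ (b ⊕ d ⊗ y) ⊕ b ⊗ a′ ⊗ y
      identity₂ = solveℕ
      identity₃ : ∀ b′ y a c b a′ → b′ ⊗ (y ⊗ a ⊕ y ⊗ c ⊗ y) ⊕ b ⊗ a′ ⊗ y ≡
        b ⊗ a′ ⊗ y ⊕ b′ ⊗ c ⊗ (y ⊗ y) ⊕ b′ ⊗ a ⊗ y
      identity₃ = solveℕ

  -- `cross v (M · v)` is the quadratic form that vanishes on the eigenvectors of `M`. Eliminating
  -- the square of the second coordinate between two such forms leaves the first coordinate times
  -- the linear form with these coefficients.
  leading middle : Matrix → Matrix → ℤ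
  leading (matrix a b c d) (matrix a′ b′ c′ d′) = + b′ * + c - + b * + c′
  middle  (matrix a b c d) (matrix a′ b′ c′ d′) = + b′ * (+ d - + a) - + b * (+ d′ - + a′)

  cross : Vector → Vector → ℤ
  cross (y₁ , y₂) (z₁ , z₂) = y₁ * z₂ - y₂ * z₁

  eliminate : ∀ {q} M M′ v → q ∣ cross v (M · v) → q ∣ cross v (M′ · v) →
    q ∣ proj₁ v * dot (leading M M′ , middle M M′) v
  eliminate (matrix a b c d) (matrix a′ b′ c′ d′) (v₁ , v₂) e e′ =
    ∣-resp (lemma (+ a) (+ b) (+ c) (+ d) (+ a′) (+ b′) (+ c′) (+ d′) v₁ v₂)
      (∣m∣n⇒∣m-n (∣n⇒∣m*n (+ b′) e) (∣n⇒∣m*n (+ b) e′))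
    where
    lemma : ∀ a b c d a′ b′ c′ d′ v₁ v₂ →
      b′ * (v₁ * (c * v₁ + d * v₂) - v₂ * (a * v₁ + b * v₂)) -
      b * (v₁ * (c′ * v₁ + d′ * v₂) - v₂ * (a′ * v₁ + b′ * v₂)) ≡
      v₁ * ((b′ * c - b * c′) * v₁ + (b′ * (d - a) - b * (d′ - a′)) * v₂)
    lemma = solve-∀

  proportional : ∀ (M M′ : Matrix) (let matrix a b c d = M ; matrix a′ b′ c′ d′ = M′) →
    leading M M′ ≡ + 0 → middle M M′ ≡ + 0 →
    b′ ℕ.* c ≡ b ℕ.* c′ × b′ ℕ.* d ℕ.+ b ℕ.* a′ ≡ b ℕ.* d′ ℕ.+ b′ ℕ.* a
  proportional (matrix a b c d) (matrix a′ b′ c′ d′) e₁ e₂ =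
    +-injective (trans (pos-* b′ c) (trans (i-j≡0⇒i≡j (+ b′ * + c) (+ b * + c′) e₁) (sym (pos-* b c′)))) ,
    +-injective (trans (cong₂ _+_ (pos-* b′ d) (pos-* b a′))
      (trans (lemma (+ b) (+ b′) (+ d) (+ d′) (+ a) (+ a′))
        (trans (cong (_+ (+ b * + d′ + + b′ * + a)) e₂)
          (trans (+-identityˡ (+ b * + d′ + + b′ * + a)) (sym (cong₂ _+_ (pos-* b d′) (pos-* b′ a)))))))
    where
    lemma : ∀ b b′ d d′ a a′ → b′ * d + b * a′ ≡ (b′ * (d - a) - b * (d′ - a′)) + (b * d′ + b′ * a)
    lemma = solve-∀

  -- Exclusion of common invariant sets.

  module Core (p : ℕ) (pp : Prime p) (c₀ : ℕ) where
    open PrimePowers p pp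

    -- PBad_ε at precision p^K, with c₀ absorbing ε and the common power of p in the coordinates.
    Bad : ℕ → Vector → Set
    Bad K y = ∀ a b → ¬ (a ≡ + 0 × b ≡ + 0) → ∀ e → e ℕ.≤ K → pw e ∣ dot (a , b) y →
      p ℕ.^ e ℕ.≤ c₀ ℕ.* maxSq a b

    ExcludedAt : List ℕ → List ℕ → ℕ → Set₁
    ExcludedAt X Y K = ∀ (S : Vector → Set) → (∀ {v} → S v → Bad K v) →
      (∀ {v} → S v → S (actL X v)) → (∀ {v} → S v → S (actL Y v)) → ∀ v → ¬ S v

    private
      small-not-divisible : ∀ {l a f} → ¬ (a ≡ + 0) → ∣ a ∣ ℕ.≤ p ℕ.^ l → pw (l ℕ.+ l) ∣ a * f → pw l ∣ f
      small-not-divisible {l} {a} {f} a≢0 a≤ d with prime-power-split l l a f d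
      ... | inj₂ e = e
      ... | inj₁ e = ⊥-elim (ℕₚ.<⇒≱ (ℕₚ.^-monoʳ-< p 1<p (ℕₚ.n<1+n l))
        (ℕₚ.≤-trans (ℕd.∣⇒≤ {{ℕ.≢-nonZero λ ∣a∣≡0 → a≢0 (∣i∣≡0⇒i≡0 ∣a∣≡0)}} (∣⇒∣ᵤ e)) a≤))

    module _ (S : Vector → Set) {K : ℕ} (bad : ∀ {y} → S y → Bad K y) where
      open Climbing p pp S

      -- The short vector `v` from `dirichlet` annihilates `y` modulo `p ^ k`. It must annihilate
      -- `z` as well, since otherwise `climb` reaches a point of `S` that contradicts `Bad`. Then
      -- `y` and `z` are nearly parallel, up to the few factors `p` that `v` can contain.
      almost-fixed : ∀ l → l ℕ.+ l ℕ.+ c₀ ℕ.≤ K → ∀ Z → (∀ {y} → S y → S (actL Z y)) → NearIdentity (pw 2) Z →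
        ∀ y → S y → pw l ∣ cross y (actL Z y)
      almost-fixed l le Z closed near y Sy = conclude (dirichlet (p ℕ.^ l) {{square≢0}} y)
        where
        square≢0 : ℕ.NonZero (p ℕ.^ l ℕ.* p ℕ.^ l)
        square≢0 = ℕₚ.m*n≢0 (p ℕ.^ l) (p ℕ.^ l) {{p^≢0 l}} {{p^≢0 l}}
        k = l ℕ.+ l
        z = actL Z y
        y₁ = proj₁ y
        y₂ = proj₂ y
        z₁ = proj₁ z
        z₂ = proj₂ z

        conclude : (Σ ℤ λ a → Σ ℤ λ b → ¬ (a ≡ + 0 × b ≡ + 0) × ∣ a ∣ ℕ.≤ p ℕ.^ l × ∣ b ∣ ℕ.≤ p ℕ.^ l ×
          (+ (p ℕ.^ l ℕ.* p ℕ.^ l) ∣ dot (a , b) y)) → pw l ∣ cross y z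
        conclude (a , b , ≢0 , a≤ , b≤ , d) = from-valuation (valuation (dot v z - dot v y) k)
          where
          v = a , b
          k∣vy : pw k ∣ dot v y
          k∣vy = subst (_∣ dot v y) (cong +_ (sym (ℕₚ.^-distribˡ-+-* p l l))) d

          too-close : ∀ {h} → h ℕ.< k → pw h ∣ dot v z - dot v y → ¬ ¬ (pw (suc h) ∣ dot v z - dot v y)
          too-close {h} h<k change exact = ℕₚ.<⇒≱ bound
            (ℕₚ.≤-trans (bad (Stage.inside top) a b ≢0 (k ℕ.+ c₀) le
                (subst (λ m → pw m ∣ dot v (Stage.point top)) reach (Stage.value top)))
              (ℕₚ.*-monoʳ-≤ c₀ (ℕₚ.⊔-lub (ℕₚ.*-mono-≤ a≤ a≤) (ℕₚ.*-mono-≤ b≤ b≤))))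
            where
            -- The climb starts at the valuation `h` of the step, to which the known divisibility of
            -- `dot v y` is weakened.
            top : Stage v (k ℕ.+ c₀ ℕ.∸ h ℕ.+ h)
            top = climb-+ (k ℕ.+ c₀ ℕ.∸ h) (record
              { word = Z ; closed = closed ; near = near ; point = y ; inside = Sy
              ; value = pw-∣ (ℕₚ.<⇒≤ h<k) k∣vy ; change = change ; exact = exact })
            reach : k ℕ.+ c₀ ℕ.∸ h ℕ.+ h ≡ k ℕ.+ c₀
            reach = ℕₚ.m∸n+n≡m (ℕₚ.≤-trans (ℕₚ.<⇒≤ h<k) (ℕₚ.m≤m+n k c₀))
            -- The surplus `c₀` in the exponent beats the factor `c₀` in `Bad` because
            -- `c₀ < p ^ c₀`.
            bound : c₀ ℕ.* (p ℕ.^ l ℕ.* p ℕ.^ l) ℕ.< p ℕ.^ (k ℕ.+ c₀)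
            bound = subst (c₀ ℕ.* (p ℕ.^ l ℕ.* p ℕ.^ l) ℕ.<_)
              (trans (cong (p ℕ.^ c₀ ℕ.*_) (sym (ℕₚ.^-distribˡ-+-* p l l)))
                (trans (ℕₚ.*-comm (p ℕ.^ c₀) (p ℕ.^ k)) (sym (ℕₚ.^-distribˡ-+-* p k c₀))))
              (ℕₚ.*-monoˡ-< (p ℕ.^ l ℕ.* p ℕ.^ l) {{square≢0}} (n<p^n c₀))

          k∣vz : pw k ∣ dot v z - dot v y → pw k ∣ dot v z
          k∣vz k∣Δ = ∣-resp (sum (dot v z) (dot v y)) (∣m∣n⇒∣m+n k∣Δ k∣vy)
            where
            sum : ∀ x y → (x - y) + y ≡ x
            sum = solve-∀

          from-valuation : (Σ ℕ λ h → h ℕ.< k × (pw h ∣ dot v z - dot v y) × ¬ (pw (suc h) ∣ dot v z - dot v y)) ⊎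
            (pw k ∣ dot v z - dot v y) → pw l ∣ cross y z
          from-valuation (inj₁ (h , h<k , change , exact)) = ⊥-elim (too-close h<k change exact)
          from-valuation (inj₂ k∣Δ) with a ≟ + 0
          -- Cramer's rule: a coordinate of `v` times the determinant of `y` and `z` is a
          -- combination of `dot v y` and `dot v z`.
          ... | no a≢0 = small-not-divisible {l} {a} a≢0 a≤ (∣-resp (lemma a b y₁ y₂ z₁ z₂)
              (∣m∣n⇒∣m-n (∣n⇒∣m*n z₂ k∣vy) (∣n⇒∣m*n y₂ (k∣vz k∣Δ))))
            where
            lemma : ∀ a b y₁ y₂ z₁ z₂ → z₂ * (a * y₁ + b * y₂) - y₂ * (a * z₁ + b * z₂) ≡ a * (y₁ * z₂ - y₂ * z₁)
            lemma = solve-∀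
          ... | yes a≡0 = small-not-divisible {l} {b} (λ b≡0 → ≢0 (a≡0 , b≡0)) b≤ (∣-resp (lemma a b y₁ y₂ z₁ z₂)
              (∣m∣n⇒∣m-n (∣n⇒∣m*n y₁ (k∣vz k∣Δ)) (∣n⇒∣m*n z₁ k∣vy)))
            where
            lemma : ∀ a b y₁ y₂ z₁ z₂ → y₁ * (a * z₁ + b * z₂) - z₁ * (a * y₁ + b * y₂) ≡ b * (y₁ * z₂ - y₂ * z₁)
            lemma = solve-∀

    -- A second letter leaves a non-empty word after `x`, whose matrix is then `Reduced`. The first
    -- letter is kept because the two forms are compared through it.
    record Power (x : ℕ) (X : List ℕ) : Set₁ where
      field
        second    : ℕ
        rest      : List ℕ
        positive  : All (1 ℕ.≤_) (second ∷ rest)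
        near      : NearIdentity (pw 2) (x ∷ second ∷ rest)
        closed    : ∀ (S : Vector → Set) → (∀ {y} → S y → S (actL X y)) →
                    ∀ {y} → S y → S (actL (x ∷ second ∷ rest) y)

    private
      repeat-head : ∀ n x xs → 1 ℕ.≤ x → All (1 ℕ.≤_) xs →
        Σ (List ℕ) λ L → repeat (suc n) (x ∷ xs) ≡ x ∷ L × All (1 ℕ.≤_) L
      repeat-head zero    x xs 1≤x ps = xs , refl , ps
      repeat-head (suc n) x xs 1≤x ps with repeat-head n x xs 1≤x ps
      ... | L , e , qs = L ++ x ∷ xs , cong (_++ (x ∷ xs)) e , Allₚ.++⁺ qs (1≤x ∷ ps)

      at-least-two : ∀ L x → Σ ℕ λ y → Σ (List ℕ) λ L′ → L ++ x ∷ L ≡ y ∷ L′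
      at-least-two []      x = x , [] , refl
      at-least-two (y ∷ L) x = y , L ++ x ∷ y ∷ L , refl

    -- Some repetition is the identity modulo the square of `p` by `finite-order`; doubling it
    -- guarantees the second letter.
    power : ∀ x xs → 1 ℕ.≤ x → All (1 ℕ.≤_) xs → Power x (x ∷ xs)
    power x xs 1≤x ps = record
      { second   = proj₁ two
      ; rest     = proj₁ (proj₂ two)
      ; positive = subst (All (1 ℕ.≤_)) (proj₂ (proj₂ two)) (Allₚ.++⁺ qs (1≤x ∷ qs))
      ; near     = subst (NearIdentity (pw 2)) shape (repeat-near {pw 2} {W} 2 (proj₂ order))
      ; closed   = λ S cl {y} Sy → subst (λ V → S (actL V y)) shape
          (closed-repeat S W (closed-repeat S (x ∷ xs) cl (suc n)) 2 Sy)
      }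
      where
      order = finite-order (p ℕ.^ 2) {{p^≢0 2}} (x ∷ xs)

      n : ℕ
      n = proj₁ order

      W : List ℕ
      W = repeat (suc n) (x ∷ xs)

      head = repeat-head n x xs 1≤x ps

      L : List ℕ
      L = proj₁ head

      qs : All (1 ℕ.≤_) L
      qs = proj₂ (proj₂ head)

      two = at-least-two L x

      shape : repeat 2 W ≡ x ∷ proj₁ two ∷ proj₁ (proj₂ two)
      shape = trans (cong₂ _++_ (proj₁ (proj₂ head)) (proj₁ (proj₂ head))) (cong (x ∷_) (proj₂ (proj₂ two)))

      closed-repeat : ∀ (S : Vector → Set) Z → (∀ {y} → S y → S (actL Z y)) →
        ∀ n {y} → S y → S (actL (repeat n Z) y)
      closed-repeat S Z cl n {y} Sy = subst S (sym (actL-repeat n Z y)) (Climbing.iter-closed p pp S {Z} cl n Sy)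

    module _ (Z Z′ : List ℕ) where
      private
        B D : ℤ
        B = leading (matrixOf Z) (matrixOf Z′)
        D = middle (matrixOf Z) (matrixOf Z′)

        -- With `p ^ l` dividing the product of `v₁` and the linear form, either `v₁` contains
        -- `suc c₀` factors `p` or the form contains `n`. Both exceed what `Bad` allows, as
        -- `c₀ < p ^ suc c₀` and `n < p ^ n`.
        n l : ℕ
        n = c₀ ℕ.* maxSq B D
        l = c₀ ℕ.+ n

      -- `almost-fixed` asks for `l + l + c₀`; one more admits the exponent `suc c₀` even when `l`
      -- is zero.
      precision : ℕ
      precision = suc (l ℕ.+ l ℕ.+ c₀)

      no-invariant : ¬ (B ≡ + 0 × D ≡ + 0) → NearIdentity (pw 2) Z → NearIdentity (pw 2) Z′ →
        ExcludedAt Z Z′ precision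
      no-invariant form≢0 near near′ S bad closed closed′ v@(v₁ , v₂) Sv =
        too-divisible (prime-power-split c₀ n v₁ (dot (B , D) v)
          (eliminate (matrixOf Z) (matrixOf Z′) v (along Z closed near) (along Z′ closed′ near′)))
        where
        l≤ : l ℕ.+ l ℕ.+ c₀ ℕ.≤ precision
        l≤ = ℕₚ.n≤1+n _

        along : ∀ Z → (∀ {v} → S v → S (actL Z v)) → NearIdentity (pw 2) Z → pw l ∣ cross v (matrixOf Z · v)
        along Z cl near = subst (λ z → pw l ∣ cross v z) (actL-matrix Z v)
          (almost-fixed S bad l l≤ Z cl near v Sv)

        unit : ∀ v₁ v₂ → v₁ ≡ + 1 * v₁ + + 0 * v₂
        unit = solve-∀

        too-divisible : ¬ ((pw (suc c₀) ∣ v₁) ⊎ (pw n ∣ dot (B , D) v))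
        too-divisible (inj₁ e) = ℕₚ.<⇒≱ (n<p^n (suc c₀)) (ℕₚ.≤-trans
          (bad Sv (+ 1) (+ 0) (λ ()) (suc c₀) (s≤s (ℕₚ.m≤n+m c₀ (l ℕ.+ l))) (∣-resp (unit v₁ v₂) e))
          (ℕₚ.≤-trans (ℕₚ.≤-reflexive (ℕₚ.*-identityʳ c₀)) (ℕₚ.n≤1+n c₀)))
        too-divisible (inj₂ e) = ℕₚ.<⇒≱ (n<p^n n) (bad Sv B D form≢0 n
          (ℕₚ.≤-trans (ℕₚ.≤-trans (ℕₚ.m≤n+m n c₀) (ℕₚ.≤-trans (ℕₚ.m≤m+n l l) (ℕₚ.m≤m+n (l ℕ.+ l) c₀))) l≤) e)

    no-common-invariant : ∀ {x xs y ys} → x ℕ.< y → 1 ℕ.≤ x → All (1 ℕ.≤_) xs → 1 ℕ.≤ y → All (1 ℕ.≤_) ys →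
      Σ ℕ (ExcludedAt (x ∷ xs) (y ∷ ys))
    no-common-invariant {x} {xs} {y} {ys} x<y 1≤x ps 1≤y qs = precision Z Z′ , λ S bad closedX closedY →
        no-invariant Z Z′ form≢0 X.near Y.near S bad (X.closed S closedX) (Y.closed S closedY)
      where
      module X = Power (power x xs 1≤x ps)
      module Y = Power (power y ys 1≤y qs)
      Z Z′ : List ℕ
      Z  = x ∷ X.second ∷ X.rest
      Z′ = y ∷ Y.second ∷ Y.rest

      form≢0 : ¬ (leading (matrixOf Z) (matrixOf Z′) ≡ + 0 × middle (matrixOf Z) (matrixOf Z′) ≡ + 0)
      form≢0 (e₁ , e₂) = not-proportional (matrixOf (X.second ∷ X.rest)) (matrixOf (Y.second ∷ Y.rest)) x<y
        (reduced (All.head X.positive) (All.tail X.positive)) (reduced (All.head Y.positive) (All.tail Y.positive)) 1≤x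
        (proj₁ eqs) (proj₂ eqs)
        where eqs = proportional (matrixOf Z) (matrixOf Z′) e₁ e₂

  -- The orbit of the point modulo `p ^ K`.

  Titer-suc : ∀ n s → Titer (suc n) s ≡ Tmap (Titer n s)
  Titer-suc zero    s = refl
  Titer-suc (suc n) s = Titer-suc n (Tmap s)

  Titer-word : ∀ n s i → proj₁ (Titer n s) i ≡ proj₁ s (n ℕ.+ i)
  Titer-word zero    s i = refl
  Titer-word (suc n) s i = Titer-word n (Tmap s) i

  module Orbit (p : ℕ) (pp : Prime p) (w : ℕ → ℕ) (x : P1 p) (u v : ℕ) (lm : LMadε p u v w (coords x)) where
    open PrimePowers p pp

    orbit : ℕ → RawPair
    orbit n = proj₂ (Titer n (w , coords x))

    orbit-suc : ∀ n → orbit (suc n) ≡ actA (w n) (orbit n)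
    orbit-suc n = trans (cong proj₂ (Titer-suc n (w , coords x)))
      (cong (λ a → actA a (orbit n)) (trans (Titer-word n (w , coords x) 0) (cong w (ℕₚ.+-identityʳ n))))

    Coherent : (ℕ → ℤ) → Set
    Coherent r = ∀ k → pw k ∣ r (suc k) - r k

    coherent-≤ : ∀ r → Coherent r → ∀ k d → pw k ∣ r (d ℕ.+ k) - r k
    coherent-≤ r coh k zero    = ∣-x-x (r k)
    coherent-≤ r coh k (suc d) = cong-trans (r (suc d ℕ.+ k)) (r (d ℕ.+ k)) (r k)
      (pw-∣ (ℕₚ.m≤n+m k d) (coh (d ℕ.+ k))) (coherent-≤ r coh k d)

    restrict : ∀ r → Coherent r → ∀ {k m} → k ℕ.≤ m → pw k ∣ r m - r k
    restrict r coh {k} {m} k≤m = subst (λ z → pw k ∣ r z - r k) (ℕₚ.m∸n+n≡m k≤m) (coherent-≤ r coh k (m ℕ.∸ k))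

    k₀ : ℕ
    k₀ = proj₁ (nonzero x)

    Proper : RawPair → Set
    Proper (r₁ , r₂) = Coherent r₁ × Coherent r₂ × ¬ ((pw k₀ ∣ r₁ k₀) × (pw k₀ ∣ r₂ k₀))

    -- The matrix of a letter is invertible over the integers, so the same `k₀` bounds the common
    -- power of `p` in the coordinates along the whole orbit.
    proper-act : ∀ a q → Proper q → Proper (actA a q)
    proper-act a (r₁ , r₂) (coh₁ , coh₂ , nz) = coh₂ ,
      (λ k → ∣-resp (lemma (+ a) (r₁ (suc k)) (r₂ (suc k)) (r₁ k) (r₂ k)) (∣m∣n⇒∣m+n (coh₁ k) (∣n⇒∣m*n (+ a) (coh₂ k)))) ,
      λ { (d₂ , d) → nz (∣m+n∣n⇒∣m d (∣n⇒∣m*n (+ a) d₂) , d₂) }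
      where
      lemma : ∀ a x₁ x₂ y₁ y₂ → (x₁ - y₁) + a * (x₂ - y₂) ≡ (x₁ + a * x₂) - (y₁ + a * y₂)
      lemma = solve-∀

    proper : ∀ n → Proper (orbit n)
    proper zero    = (λ k → ∣ᵤ⇒∣ (coh (q₁ x) k)) , (λ k → ∣ᵤ⇒∣ (coh (q₂ x) k)) , nz (proj₂ (nonzero x))
      where
      nz : ¬ ((+ (p ℕ.^ k₀)) ℤd.∣ res (q₁ x) k₀) ⊎ ¬ ((+ (p ℕ.^ k₀)) ℤd.∣ res (q₂ x) k₀) →
        ¬ ((pw k₀ ∣ res (q₁ x) k₀) × (pw k₀ ∣ res (q₂ x) k₀))
      nz (inj₁ ¬d) (d , _) = ¬d (∣⇒∣ᵤ d)
      nz (inj₂ ¬d) (_ , d) = ¬d (∣⇒∣ᵤ d)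
    proper (suc n) = subst Proper (sym (orbit-suc n)) (proper-act (w n) (orbit n) (proper n))

    -- The factor `p ^ k₀` pays for a common power of `p` in the coordinates, and `suc v` is an
    -- upper bound for the inverse of `ε`.
    c₀ : ℕ
    c₀ = p ℕ.^ k₀ ℕ.* suc v

    open Core p pp c₀ using (Bad; ExcludedAt)

    level : ℕ → ℕ → Vector
    level K n = proj₁ (orbit n) K , proj₂ (orbit n) K

    level-suc : ∀ K n → level K (suc n) ≡ actV (w n) (level K n)
    level-suc K n = cong (λ q → proj₁ q K , proj₂ q K) (orbit-suc n)

    -- The exponent `j` is below `k₀`, as the coordinates are not both divisible by `p ^ k₀`. So
    -- divisibility by `p ^ e` forces `e ≤ k₀ + κ`, and `PBadε` bounds `p ^ κ`.
    level-bad : ∀ K n → Bad K (level K n)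
    level-bad K n a b ≢0 e e≤K e∣ with orbit n | proper n | proj₂ (lm n)
    ... | r₁ , r₂ | coh₁ , coh₂ , nz | pbad with pbad a b ≢0
    ... | κ , κ≤ , j , j∣r₁ , j∣r₂ , ¬H∣ = begin
        p ℕ.^ e                          ≤⟨ ℕₚ.^-monoʳ-≤ p (ℕₚ.≤-trans (ℕ.s≤s⁻¹ e<H) (ℕₚ.+-monoˡ-≤ κ (ℕₚ.<⇒≤ j<k₀))) ⟩
        p ℕ.^ (k₀ ℕ.+ κ)                 ≡⟨ ℕₚ.^-distribˡ-+-* p k₀ κ ⟩
        p ℕ.^ k₀ ℕ.* p ℕ.^ κ             ≤⟨ ℕₚ.*-monoʳ-≤ (p ℕ.^ k₀) (ℕₚ.≤-trans (ℕₚ.m≤m*n (p ℕ.^ κ) (suc u)) κ≤) ⟩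
        p ℕ.^ k₀ ℕ.* (maxSq a b ℕ.* suc v) ≡⟨ cong (p ℕ.^ k₀ ℕ.*_) (ℕₚ.*-comm (maxSq a b) (suc v)) ⟩
        p ℕ.^ k₀ ℕ.* (suc v ℕ.* maxSq a b) ≡⟨ sym (ℕₚ.*-assoc (p ℕ.^ k₀) (suc v) (maxSq a b)) ⟩
        c₀ ℕ.* maxSq a b                 ∎
      where
      open ℕₚ.≤-Reasoning
      H : ℕ
      H = suc (j ℕ.+ κ)

      back : ∀ x y → x - (x - y) ≡ y
      back = solve-∀

      lower : ∀ r {k m} → Coherent r → k ℕ.≤ m → pw k ∣ r m → pw k ∣ r k
      lower r {k} {m} coh k≤m d = ∣-resp (back (r m) (r k)) (∣m∣n⇒∣m-n d (restrict r coh k≤m))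

      j<k₀ : j ℕ.< k₀
      j<k₀ = ℕₚ.≰⇒> λ k₀≤j → nz (lower r₁ coh₁ k₀≤j (pw-∣ k₀≤j (∣ᵤ⇒∣ j∣r₁)) , lower r₂ coh₂ k₀≤j (pw-∣ k₀≤j (∣ᵤ⇒∣ j∣r₂)))

      form : ℕ → ℤ
      form k = a * r₁ k + b * r₂ k

      form-coherent : Coherent form
      form-coherent k = ∣-resp (lemma a b (r₁ (suc k)) (r₁ k) (r₂ (suc k)) (r₂ k))
        (∣m∣n⇒∣m+n (∣n⇒∣m*n a (coh₁ k)) (∣n⇒∣m*n b (coh₂ k)))
        where
        lemma : ∀ a b x₁ y₁ x₂ y₂ → a * (x₁ - y₁) + b * (x₂ - y₂) ≡ (a * x₁ + b * x₂) - (a * y₁ + b * y₂)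
        lemma = solve-∀

      e<H : e ℕ.< H
      e<H = ℕₚ.≰⇒> λ H≤e → ¬H∣ (∣⇒∣ᵤ (lower form form-coherent (ℕₚ.≤-trans H≤e e≤K) (pw-∣ H≤e e∣)))

    bad-resp : ∀ K {y z} → Congruent (pw K) y z → Bad K y → Bad K z
    bad-resp K {y₁ , y₂} {z₁ , z₂} (d₁ , d₂) bad a b ≢0 e e≤K e∣ = bad a b ≢0 e e≤K
      (∣-resp (lemma a b y₁ y₂ z₁ z₂) (∣m∣n⇒∣m+n (pw-∣ e≤K (∣m∣n⇒∣m+n (∣n⇒∣m*n a d₁) (∣n⇒∣m*n b d₂))) e∣))
      where
      lemma : ∀ a b y₁ y₂ z₁ z₂ → (a * (y₁ - z₁) + b * (y₂ - z₂)) + (a * z₁ + b * z₂) ≡ a * y₁ + b * y₂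
      lemma = solve-∀

    -- Elements of the invariant set are orbit states only up to `¬ ¬`; the conclusion of `Bad` is a
    -- decidable inequality, so this does no harm.
    bad-stable : ∀ K {y} → ¬ ¬ Bad K y → Bad K y
    bad-stable K ¬¬bad a b ≢0 e e≤K e∣ = decidable-stable (_ ℕ.≤? _) λ ¬le →
      ¬¬bad λ bad → ¬le (bad a b ≢0 e e≤K e∣)

    module _ (T : ℕ) (R : Words.Recurrence (tail T w)) (C : ℕ) (cx : Words.Complexity≤ (tail T w) C)
             (¬ep : ¬ EventuallyPeriodic (tail T w)) (positive : ∀ i → 1 ℕ.≤ w i) where
      open Recurrent (tail T w) R C cx ¬ep

      letters-positive : ∀ i m → All (1 ℕ.≤_) (letters (tail T w) i m)
      letters-positive i zero    = []
      letters-positive i (suc m) = positive (T ℕ.+ i) ∷ letters-positive (suc i) m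

      module _ (X Y : List ℕ) (invariant : AlwaysInvariant X Y) where

        refuted : ¬ Σ ℕ (ExcludedAt X Y)
        -- `K` is given first; `invariant` is then applied to the orbit modulo `p ^ K`, which is
        -- possible as its words do not depend on the modulus.
        refuted (K , none) = invariant space Q step λ { (S , (v , Sv) , closedX , closedY , seen) →
          none S (λ {v} Sv → bad-stable K {v} (seen Sv >>= λ { (k , k≈v) →
              return (bad-resp K k≈v (level-bad K (T ℕ.+ k))) }))
            (λ {v} Sv → subst S (actList-modular m {{nz}} X v) (closedX Sv))
            (λ {v} Sv → subst S (actList-modular m {{nz}} Y v) (closedY Sv)) v Sv }
          where
          m : ℕ
          m = p ℕ.^ K
          nz : ℕ.NonZero m
          nz = p^≢0 K
          space : StateSpace
          space = modular m {{nz}}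
          open StateSpace space
          Q : ℕ → Vector
          Q i = level K (T ℕ.+ i)
          step : ∀ i → Q (suc i) ≈ act (tail T w i) (Q i)
          step i = subst (Q (suc i) ≈_)
            (trans (cong (level K) (ℕₚ.+-suc T i)) (level-suc K (T ℕ.+ i))) (≈-refl {Q (suc i)})

      contradictory : ⊥
      contradictory = two-loops λ { (i , j , a , b , ne , invariant) → compare i j a b ne invariant }
        where
        open Core p pp c₀ using (no-common-invariant)
        compare : ∀ i j a b → tail T w i ≢ tail T w j →
          AlwaysInvariant (letters (tail T w) i (suc a)) (letters (tail T w) j (suc b)) → ⊥
        compare i j a b ne invariant with ℕₚ.<-cmp (tail T w i) (tail T w j)
        ... | tri≈ _ e _ = ne e
        ... | tri< lt _ _ = refuted (letters (tail T w) i (suc a)) (letters (tail T w) j (suc b)) invariant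
          (no-common-invariant lt (positive _) (letters-positive (suc i) a) (positive _) (letters-positive (suc j) b))
        ... | tri> _ _ gt = refuted (letters (tail T w) i (suc a)) (letters (tail T w) j (suc b)) invariant
          (swap {letters (tail T w) j (suc b)} {letters (tail T w) i (suc a)}
            (no-common-invariant gt (positive _) (letters-positive (suc j) b) (positive _) (letters-positive (suc i) a)))
          where
          swap : ∀ {X Y} → Σ ℕ (ExcludedAt X Y) → Σ ℕ (ExcludedAt Y X)
          swap (K , none) = K , λ S bad closedX closedY → none S bad closedY closedX

open Arithmetic
open import Data.Nat using (_+_; _≤_)

theorem2 : (p : ℕ) → Prime p → (N : ℕ) → (w : ℕ → ℕ) → InAlphabet N w →
    ¬ EventuallyPeriodic w →
    (Σ ℕ λ C → 1 ≤ C × (∀ n → ComplexityAtMost w n (n + C))) →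
    (x : P1 p) → ¬ LMad p w (coords x)
theorem2 p pp N w alphabet ¬ep (C , _ , cx) x (u , v , lm) = tail-recurrence w cx′ ¬ep λ { (T , R) →
  Orbit.contradictory p pp w x u v lm T R C
    (tail-complexity w T cx′) (tail-¬periodic w T ¬ep) (λ i → proj₁ (alphabet i)) }
  where
  cx′ : Words.Complexity≤ w C
  cx′ = complexity≤ w cx
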